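{- (i) The point $P$ with coordinates $$X = -\frac{12(m^6-4m^2-3)}{m^2},\qquad Y = \frac{216(m^2+1)^2}{m^3}$$ is a rational point, not of finite order, on the elliptic curve over the function field $\mathbb{Q}(m)$ given by $$Y^2 = X^3 - 432(m^4-2m^2-2)(m^2+1)^2X - 1728(m^2-1)(m^2+1)^3(2m^4-4m^2-7),$$ so that infinitely many rational points on this curve can be generated using the group law. (ii) Each of these rational points yields a corresponding rational point on the curve over $\mathbb{Q}(m)$ $$V^2 = U^4 - 4(m^2+1)U^3 - 2(m^2+1)(2m^4-2m^2-3)U^2 - 4(m^2+1)^2U + (m^2+1)^2,$$ and, using the relations $t=ms$, $u=sU$, $v=s^2V$, one can find infinitely many parametric solutions of the diophantine equation $$v^2 = u^4 - \frac{4(s^2+t^2)}{s}u^3 + \frac{2(s^2+t^2)(3s^4+2s^2t^2-2t^4)}{s^4}u^2 - \frac{4(s^2+t^2)^2}{s}u + (s^2+t^2)^2.$$ (iii) One can thus obtain infinitely many parametric solutions of the problem of finding three integers $a,b,c$ such that $a+b+c$, $ab+bc+ca$ and $abc$ are all perfect squares.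
   Context: Here $m$ is an indeterminate over $\mathbb{Q}$; the two curves in (i) and (ii) are regarded as elliptic curves over $\mathbb{Q}(m)$ (the second as a quartic model), related by a birational transformation, and "rational point" means a point with coordinates in $\mathbb{Q}(m)$. In the last equation of (ii), $s,t,u,v$ are rational variables. Each rational solution of that equation gives a value of $u$ for which the quadratic equation $t^2x^2 - s(s^3 - 2s^2u + st^2 + su^2 - 2t^2u)x + u^2t^2(s^2+t^2)=0$ has two rational roots $x$; these together with $s^2+t^2$ are three rational numbers whose elementary symmetric functions are all squares of rational numbers, and multiplying them by a suitable perfect square gives integers. -}

module Defs where

open import Level using (0ℓ)
open import Algebra.Bundles.Raw using (RawRing; RawMonoid)
import Algebra.Definitions.RawMonoid
import Algebra.Definitions.RawSemiring
open import Data.Bool.Base using (if_then_else_)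
open import Data.Empty using (⊥)
open import Data.Fin.Patterns using (0F; 1F; 2F)
open import Data.Fin.Permutation using (Permutation′; _⟨$⟩ʳ_)
open import Data.Integer.Base as ℤ using (ℤ; 0ℤ)
open import Data.List.Base using (List; []; _∷_; map; foldr)
open import Data.List.Relation.Unary.All as All using (All; []; _∷_)
open import Data.Nat.Base as ℕ using (ℕ)
open import Data.Product.Base using (_×_; _,_; ∃; ∃-syntax)
open import Data.Rational.Base as ℚ using (ℚ; 0ℚ; 1ℚ)
import Data.Rational.Properties as ℚₚ
open import Data.Unit.Base using (⊤)
open import Data.Vec.Functional using (Vector)
open import Relation.Binary.PropositionalEquality
  using (_≡_; refl; sym; trans; cong; cong₂; subst; module ≡-Reasoning)
open import Relation.Nullary.Decidable using (Dec; yes; no; ⌊_⌋)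
open import Relation.Nullary.Negation using (¬_; contradiction)

-- Coefficients are listed from degree 0 upwards.  Trailing zeros are allowed,
-- so a polynomial is zero when all its listed coefficients are.

ℚ[m] : Set
ℚ[m] = List ℚ

IsZero : ℚ[m] → Set
IsZero = All (_≡ 0ℚ)

isZero? : ∀ p → Dec (IsZero p)
isZero? = All.all? (ℚₚ._≟ 0ℚ)

infixl 6 _+ₚ_
infixl 7 _*ₚ_
infix  8 -ₚ_

_+ₚ_ : ℚ[m] → ℚ[m] → ℚ[m]
[]      +ₚ q       = q
(a ∷ p) +ₚ []      = a ∷ p
(a ∷ p) +ₚ (b ∷ q) = (a ℚ.+ b) ∷ (p +ₚ q)

-ₚ_ : ℚ[m] → ℚ[m]
-ₚ_ = map (λ a → ℚ.- a)

_*ₚ_ : ℚ[m] → ℚ[m] → ℚ[m]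
[]      *ₚ q = []
(a ∷ p) *ₚ q = map (a ℚ.*_) q +ₚ (0ℚ ∷ p *ₚ q)

-- ℚ[m] has no zero divisors, so denominators may be multiplied.

private

  +ₚ-assoc : ∀ p q r → (p +ₚ q) +ₚ r ≡ p +ₚ (q +ₚ r)
  +ₚ-assoc []      q       r       = refl
  +ₚ-assoc (a ∷ p) []      r       = refl
  +ₚ-assoc (a ∷ p) (b ∷ q) []      = refl
  +ₚ-assoc (a ∷ p) (b ∷ q) (c ∷ r) =
    cong₂ _∷_ (ℚₚ.+-assoc a b c) (+ₚ-assoc p q r)

  +ₚ-identityʳ : ∀ p → p +ₚ [] ≡ p
  +ₚ-identityʳ []      = refl
  +ₚ-identityʳ (a ∷ p) = refl

  dropZeros : ∀ p q → IsZero p → IsZero (p +ₚ q) → IsZero q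
  dropZeros []      q       _          z        = z
  dropZeros (a ∷ p) []      _          _        = []
  dropZeros (a ∷ p) (b ∷ q) (a≡0 ∷ zp) (e ∷ z) =
    trans (sym (ℚₚ.+-identityˡ b)) (trans (cong (ℚ._+ b) (sym a≡0)) e)
    ∷ dropZeros p q zp z

  scaleByZero : ∀ {a} q → a ≡ 0ℚ → IsZero (map (a ℚ.*_) q)
  scaleByZero []      _    = []
  scaleByZero (b ∷ q) refl = ℚₚ.*-zeroˡ b ∷ scaleByZero q refl

  c*0+0 : ∀ c → c ℚ.* 0ℚ ℚ.+ 0ℚ ≡ 0ℚ
  c*0+0 c = trans (ℚₚ.+-identityʳ _) (ℚₚ.*-zeroʳ c)

  shift : ∀ r p q → IsZero (r +ₚ p *ₚ (0ℚ ∷ q)) → IsZero (r +ₚ (0ℚ ∷ p *ₚ q))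
  shift []      []      q z       = refl ∷ []
  shift (x ∷ r) []      q (e ∷ z) =
    trans (ℚₚ.+-identityʳ x) e ∷ subst IsZero (sym (+ₚ-identityʳ r)) z
  shift []      (c ∷ p) q (e ∷ z) = refl ∷ shift (map (c ℚ.*_) q) p q z
  shift (x ∷ r) (c ∷ p) q (e ∷ z) =
    trans (cong (x ℚ.+_) (sym (c*0+0 c))) e
    ∷ subst IsZero (+ₚ-assoc r cq _)
        (shift (r +ₚ cq) p q (subst IsZero (sym (+ₚ-assoc r cq _)) z))
    where cq = map (c ℚ.*_) q

  a*b≡0⇒b≡0 : ∀ a b → ¬ a ≡ 0ℚ → a ℚ.* b ≡ 0ℚ → b ≡ 0ℚ
  a*b≡0⇒b≡0 a b a≢0 ab≡0 = begin
    b                        ≡⟨ ℚₚ.*-identityˡ b ⟨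
    1ℚ ℚ.* b                 ≡⟨ cong (ℚ._* b) (ℚₚ.*-inverseˡ a) ⟨
    (ℚ.1/ a) ℚ.* a ℚ.* b     ≡⟨ ℚₚ.*-assoc (ℚ.1/ a) a b ⟩
    (ℚ.1/ a) ℚ.* (a ℚ.* b)   ≡⟨ cong ((ℚ.1/ a) ℚ.*_) ab≡0 ⟩
    (ℚ.1/ a) ℚ.* 0ℚ          ≡⟨ ℚₚ.*-zeroʳ (ℚ.1/ a) ⟩
    0ℚ                       ∎
    where
    open ≡-Reasoning
    instance _ = ℚ.≢-nonZero a≢0

  nonZeroHead : ∀ a p q → ¬ a ≡ 0ℚ → IsZero ((a ∷ p) *ₚ q) → IsZero q
  nonZeroHead a p []      a≢0 z       = []
  nonZeroHead a p (b ∷ q) a≢0 (e ∷ z) =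
    b≡0 ∷ nonZeroHead a p q a≢0
      (shift (map (a ℚ.*_) q) p q
        (subst (λ c → IsZero (map (a ℚ.*_) q +ₚ p *ₚ (c ∷ q))) b≡0 z))
    where
    b≡0 : b ≡ 0ℚ
    b≡0 = a*b≡0⇒b≡0 a b a≢0 (trans (sym (ℚₚ.+-identityʳ _)) e)

  integral : ∀ p q → IsZero (p *ₚ q) → ¬ IsZero q → IsZero p
  integral []      q z nz = []
  integral (a ∷ p) q z nz with a ℚₚ.≟ 0ℚ
  ... | no a≢0  = contradiction (nonZeroHead a p q a≢0 z) nz
  ... | yes a≡0 = a≡0 ∷ integral p q
    (All.tail (dropZeros _ (0ℚ ∷ p *ₚ q) (scaleByZero q a≡0) z)) nz

*ₚ-nonZero : ∀ p q → ¬ IsZero p → ¬ IsZero q → ¬ IsZero (p *ₚ q)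
*ₚ-nonZero p q p≢0 q≢0 z = p≢0 (integral p q z q≢0)

infix 5 _÷_[_]

record K : Set where
  constructor _÷_[_]
  field
    num     : ℚ[m]
    den     : ℚ[m]
    den≢0   : ¬ IsZero den

open K public

private
  1≢0 : ¬ IsZero (1ℚ ∷ [])
  1≢0 (() ∷ _)

polynomial : ℚ[m] → K
polynomial p = p ÷ 1ℚ ∷ [] [ 1≢0 ]

K-rawRing : RawRing 0ℓ 0ℓ
K-rawRing = record
  { Carrier = K
  ; _≈_     = λ x y → IsZero (num x *ₚ den y +ₚ -ₚ (num y *ₚ den x))
  ; _+_     = λ x y → num x *ₚ den y +ₚ num y *ₚ den x ÷ den x *ₚ den y
                        [ *ₚ-nonZero (den x) (den y) (den≢0 x) (den≢0 y) ]
  ; _*_     = λ x y → num x *ₚ num y ÷ den x *ₚ den y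
                        [ *ₚ-nonZero (den x) (den y) (den≢0 x) (den≢0 y) ]
  ; -_      = λ x → -ₚ num x ÷ den x [ den≢0 x ]
  ; 0#      = polynomial []
  ; 1#      = polynomial (1ℚ ∷ [])
  }

open RawRing K-rawRing public
  using (_≈_; _≉_; _+_; _*_; -_; 0#; 1#)
open Algebra.Definitions.RawSemiring (RawRing.rawSemiring K-rawRing) public
  using (_^_)

infixl 6 _-_
infixl 7 _/_
infix  9 _⁻¹
infix  9 #_
infix  4 _≟_

_≟_ : (x y : K) → Dec (x ≈ y)
x ≟ y = isZero? _

_-_ : K → K → K
x - y = x + - y

-- Totalised by 0 ⁻¹ = 0.
_⁻¹ : K → K
x ⁻¹ with isZero? (num x)
... | yes _  = 0#
... | no x≢0 = den x ÷ num x [ x≢0 ]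

_/_ : K → K → K
x / y = x * y ⁻¹

#_ : ℕ → K
# n = polynomial ((ℤ.+ n) ℚ./ 1 ∷ [])

m : K
m = polynomial (0ℚ ∷ 1ℚ ∷ [])

data Point : Set where
  ∞   : Point
  aff : (x y : K) → Point

infix 4 _≈ₚ_ _≉ₚ_

_≈ₚ_ : Point → Point → Set
∞       ≈ₚ ∞         = ⊤
∞       ≈ₚ aff _ _   = ⊥
aff _ _ ≈ₚ ∞         = ⊥
aff x y ≈ₚ aff x′ y′ = x ≈ x′ × y ≈ y′

_≉ₚ_ : Point → Point → Set
P ≉ₚ Q = ¬ (P ≈ₚ Q)

module Weierstrass (α β : K) where

  Nonsingular : Set
  Nonsingular = # 4 * α ^ 3 + # 27 * β ^ 2 ≉ 0#

  OnCurve : Point → Set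
  OnCurve ∞         = ⊤
  OnCurve (aff x y) = y ^ 2 ≈ x ^ 3 + α * x + β

  -- The point opposite to the third intersection of the curve with the line of
  -- slope l through (x₁ , y₁), where x₁ and x₂ are two abscissae of the
  -- intersection.
  third : (l x₁ y₁ x₂ : K) → Point
  third l x₁ y₁ x₂ = aff x₃ (l * (x₁ - x₃) - y₁)
    where x₃ = l ^ 2 - x₁ - x₂

  infixl 6 _⊕_

  _⊕_ : Point → Point → Point
  ∞         ⊕ Q         = Q
  aff x₁ y₁ ⊕ ∞         = aff x₁ y₁
  aff x₁ y₁ ⊕ aff x₂ y₂ =
    if ⌊ x₁ ≟ x₂ ⌋
    then (if ⌊ y₁ ≟ - y₂ ⌋
          then ∞
          else third ((# 3 * x₁ ^ 2 + α) / (# 2 * y₁)) x₁ y₁ x₂)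
    else third ((y₂ - y₁) / (x₂ - x₁)) x₁ y₁ x₂

  rawMonoid : RawMonoid 0ℓ 0ℓ
  rawMonoid = record { Carrier = Point ; _≈_ = _≈ₚ_ ; _∙_ = _⊕_ ; ε = ∞ }

  open Algebra.Definitions.RawMonoid rawMonoid public
    using () renaming (_×_ to infixr 8 _·_)

D : K
D = m ^ 2 + # 1

module E = Weierstrass
  (- (# 432 * (m ^ 4 - # 2 * m ^ 2 - # 2) * D ^ 2))
  (- (# 1728 * (m ^ 2 - # 1) * D ^ 3 * (# 2 * m ^ 4 - # 4 * m ^ 2 - # 7)))

P : Point
P = aff (- (# 12 * (m ^ 6 - # 4 * m ^ 2 - # 3)) / m ^ 2)
        (# 216 * D ^ 2 / m ^ 3)

OnQuartic : K → K → Set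
OnQuartic U V =
  V ^ 2 ≈ U ^ 4 - # 4 * D * U ^ 3
          - # 2 * D * (# 2 * m ^ 4 - # 2 * m ^ 2 - # 3) * U ^ 2
          - # 4 * D ^ 2 * U + D ^ 2

-- The quartic equation reads  V² = W² - 4 D m⁴ U²  with  W = U² - 2 D U + D.
-- Put Z = V + W.  Eliminating V gives an equation quadratic in U,
--   (2 Z - 4 D m⁴) U² - 4 D Z U + (2 D Z - Z²) = 0,
-- whose discriminant must be a square; this is the cubic curve after the
-- substitution  Z = m² (X + 12 (m⁴ - 1)) / 18, the square root of the quarter
-- discriminant being m³ Y / 54.  The sign of this square root in toU is the
-- one for which P itself does not go to the point (0 , D).  The leading
-- coefficient 2 Z - 4 D m⁴ vanishes exactly at X = excludedX.

excludedX : K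
excludedX = # 12 * D * (# 2 * m ^ 2 + # 1)

toU toV : K → K → K
toU X Y = (m * Y + # 6 * D * X + # 72 * D ^ 2 * (m ^ 2 - # 1))
          / (# 6 * (X - excludedX))
toV X Y = m ^ 2 * (X + # 12 * (m ^ 4 - # 1)) / # 18
          - (U ^ 2 - # 2 * D * U + D)
  where U = toU X Y

fromX fromY : K → K → K
fromX U V = # 18 * Z / m ^ 2 - # 12 * (m ^ 4 - # 1)
  where Z = V + U ^ 2 - # 2 * D * U + D
fromY U V = # 108 * (U * (Z - # 2 * D * m ^ 4) - D * Z) / m ^ 3
  where Z = V + U ^ 2 - # 2 * D * U + D

Diophantine : (s t u v : K) → Set
Diophantine s t u v =
  v ^ 2 ≈ u ^ 4 - # 4 * (s ^ 2 + t ^ 2) / s * u ^ 3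
          + # 2 * (s ^ 2 + t ^ 2)
                * (# 3 * s ^ 4 + # 2 * s ^ 2 * t ^ 2 - # 2 * t ^ 4) / s ^ 4
                * u ^ 2
          - # 4 * (s ^ 2 + t ^ 2) ^ 2 / s * u
          + (s ^ 2 + t ^ 2) ^ 2

quadratic : (s t u x : K) → K
quadratic s t u x =
  t ^ 2 * x ^ 2
  - s * (s ^ 3 - # 2 * s ^ 2 * u + s * t ^ 2 + s * u ^ 2 - # 2 * t ^ 2 * u) * x
  + u ^ 2 * t ^ 2 * (s ^ 2 + t ^ 2)

-- x₁ and x₂ are the two roots of the quadratic, counted with multiplicity.
Roots : (s t u x₁ x₂ : K) → Set
Roots s t u x₁ x₂ = ∀ x → quadratic s t u x ≈ t ^ 2 * ((x - x₁) * (x - x₂))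

ℤ[m] : Set
ℤ[m] = List ℤ

eval : ℤ[m] → ℤ → ℤ
eval p k = foldr (λ a r → a ℤ.+ k ℤ.* r) 0ℤ p

ι : ℤ[m] → K
ι p = polynomial (map (ℚ._/ 1) p)

Triple : Set → Set
Triple A = Vector A 3

-- The square roots of the elementary symmetric functions are themselves
-- required to be integer polynomials in the parameter.
IsParametricSolution : Triple ℤ[m] → Set
IsParametricSolution f = ∃[ p ] ∃[ q ] ∃[ r ] ∀ k →
  let a = eval (f 0F) k
      b = eval (f 1F) k
      c = eval (f 2F) k
  in a ℤ.+ b ℤ.+ c                         ≡ eval p k ℤ.* eval p k
   × a ℤ.* b ℤ.+ b ℤ.* c ℤ.+ c ℤ.* a       ≡ eval q k ℤ.* eval q k
   × a ℤ.* b ℤ.* c                         ≡ eval r k ℤ.* eval r k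

-- The triple consists of s² + t² and the two roots, multiplied by a perfect
-- square.
ArisesFrom : (s t u : K) → Triple ℤ[m] → Set
ArisesFrom s t u f = ∃[ x₁ ] ∃[ x₂ ] ∃[ g ]
  Roots s t u x₁ x₂ × g ≉ 0#
  × ι (f 0F) ≈ g ^ 2 * (s ^ 2 + t ^ 2)
  × ι (f 1F) ≈ g ^ 2 * x₁
  × ι (f 2F) ≈ g ^ 2 * x₂

-- Multiplying a solution by a square, or reordering it, gives nothing new.
-- Solutions are therefore compared up to order and a common factor.
Similar : Triple ℤ[m] → Triple ℤ[m] → Set
Similar f f′ = ∃ λ (σ : Permutation′ 3) → ∃[ c ] c ≉ 0# × (∀ i → ι (f i) ≈ c * ι (f′ (σ ⟨$⟩ʳ i)))

-- At the place m = 0 the point P reduces to the point at infinity: its coordinates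
-- have the leading terms 36 m⁻² and 216 m⁻³.  In the kernel of reduction the group
-- law is additive to first order, so n P has the leading terms 36 (n m)⁻² and
-- 216 (n m)⁻³.  This survives the explicit chord and tangent formulas, by induction
-- on n and without the associativity of the group law, and it separates all the
-- multiples of P.  The value of U at m = 0 is then 1 + 1/n.
--
-- With W = U² - 2 D U + D the quadratic has the roots s² (W ± V) / (2 m²), and for the
-- triple D, (W + V) / (2 m²), (W - V) / (2 m²) the elementary symmetric functions are
-- ((D - U) / m)², (D (U - 1) / m)² and (U D)².  The quotient e₁ e₂ / e₃ is unchanged
-- under scaling and permuting the triple, and m⁴ e₁ e₂ / e₃ has the value
-- (n (n + 1))⁻² at m = 0, so that no two triples are similar.

module Submission where

-- First-order additivity has a geometric source. `m⁴ α` and `m⁶ β` vanish at m = 0, so the leading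
-- coefficients of a multiple of P lie on the cuspidal cubic Y² = X³. Its point (36 z⁻², 216 z⁻³)
-- has the additive parameter z: chords and tangents add parameters.
--
-- No power series and no valuation are used. A function with a pole is multiplied by powers of `m`
-- and of the index until it is regular at m = 0 with an integer value, and such values are compared
-- by ring identities in ℤ. The same notion of value at all places m = k turns the square identities
-- in `K` into the numerical ones that define a parametric solution.
--
-- Both directions of the birational transformation come from one completed square: 2916 (2 Z - 4 D
-- m⁴) times the quadratic in U is the square of `root` minus a monic cubic at 18 Z, and that cubic
-- at m² (X + 12 (m⁴ - 1)) is `m⁶` times the right-hand side of the Weierstrass equation.
--
-- The algebra is done in an abstract field by a solver with integer coefficients; an inverse enters
-- as one more unknown, constrained by its defining equation.

open import Algebra.Bundles using (CommutativeRing)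
import Algebra.Consequences.Setoid as Consequences
open import Algebra.Definitions
  using (Associative; Commutative; Congruent₁; Congruent₂; LeftIdentity; LeftInverse; _DistributesOverˡ_)
import Algebra.Properties.CommutativeSemigroup
import Algebra.Solver.Ring
open import Algebra.Solver.Ring.AlmostCommutativeRing
  using (fromCommutativeRing; _-Raw-AlmostCommutative⟶_)
open import Algebra.Structures using (IsCommutativeRing)
open import Data.Bool.Base using (if_then_else_)
open import Data.Fin.Base using (Fin)
open import Data.Fin.Patterns using (0F; 1F; 2F; 3F; 4F)
open import Data.Fin.Permutation using (Permutation′; _⟨$⟩ʳ_)
open import Data.Integer.Base as ℤ using (ℤ)
import Data.Integer.Properties as ℤₚ
open import Data.Integer.Solver using () renaming (module +-*-Solver to Z)
open import Data.List.Base using ([]; _∷_; map; length)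
open import Data.List.Relation.Unary.All using (All; []; _∷_)
open import Data.Maybe.Base using (just; nothing)
open import Data.Nat.Base as ℕ using (ℕ; zero; suc)
import Data.Nat.Properties as ℕₚ
open import Data.Product.Base using (_×_; _,_; proj₁; proj₂; ∃-syntax; Σ-syntax)
open import Data.Rational.Base as ℚ using (ℚ; mkℚ; 0ℚ; 1ℚ)
import Data.Rational.Properties as ℚₚ
open import Data.Rational.Solver using () renaming (module +-*-Solver to Q)
open import Data.Rational.Unnormalised.Base as ℚᵘ using (mkℚᵘ)
import Data.Rational.Unnormalised.Properties as ℚᵘₚ
open import Data.Sum.Base using (inj₁; inj₂; [_,_]′)
open import Data.Unit.Base using (tt)
open import Data.Vec.Base using (Vec; []; _∷_; lookup)
open import Data.Vec.Functional using (Vector)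
open import Data.Vec.Relation.Binary.Pointwise.Inductive as Pw using (Pointwise; []; _∷_)
open import Level using (0ℓ)
open import Relation.Binary.Bundles using (Setoid)
open import Relation.Binary.Definitions using (WeaklyDecidable; tri<; tri≈; tri>)
open import Relation.Binary.PropositionalEquality as ≡ using (_≡_; _≢_)
open import Relation.Binary.Structures using (IsEquivalence)
open import Relation.Nullary.Decidable using (Dec; yes; no; ⌊_⌋; decidable-stable)
open import Relation.Nullary.Negation using (¬_; contradiction)

-- _≈_ on K is not injective in its arguments, so that the implicit arguments of
-- the structures below can only be inferred for an abstract relation.
module FromLaws
  {A : Set} (_≈_ : A → A → Set) (_+_ _*_ : A → A → A) (neg : A → A) (0# 1# : A)
  (isEquivalence : IsEquivalence _≈_)
  (+-cong : Congruent₂ _≈_ _+_) (*-cong : Congruent₂ _≈_ _*_) (-‿cong : Congruent₁ _≈_ neg)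
  (+-assoc : Associative _≈_ _+_) (*-assoc : Associative _≈_ _*_)
  (+-comm : Commutative _≈_ _+_) (*-comm : Commutative _≈_ _*_)
  (+-identityˡ : LeftIdentity _≈_ 0# _+_) (*-identityˡ : LeftIdentity _≈_ 1# _*_)
  (-‿inverseˡ : LeftInverse _≈_ 0# neg _+_) (distribˡ : _DistributesOverˡ_ _≈_ _*_ _+_)
  where

  private
    setoid : Setoid 0ℓ 0ℓ
    setoid = record { isEquivalence = isEquivalence }

  open Consequences setoid

  isCommutativeRing : IsCommutativeRing _≈_ _+_ _*_ neg 0# 1#
  isCommutativeRing = record
    { isRing = record
      { +-isAbelianGroup = record
        { isGroup = record
          { isMonoid = record
            { isSemigroup = record
              { isMagma = record { isEquivalence = isEquivalence ; ∙-cong = +-cong }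
              ; assoc = +-assoc }
            ; identity = comm∧idˡ⇒id +-comm +-identityˡ }
          ; inverse = comm∧invˡ⇒inv +-comm -‿inverseˡ
          ; ⁻¹-cong = -‿cong }
        ; comm = +-comm }
      ; *-cong = *-cong
      ; *-assoc = *-assoc
      ; *-identity = comm∧idˡ⇒id *-comm *-identityˡ
      ; distrib = comm∧distrˡ⇒distr +-cong *-comm distribˡ }
    ; *-comm = *-comm }

module _ (R : CommutativeRing 0ℓ 0ℓ) where

  open CommutativeRing R
  open import Relation.Binary.Reasoning.Setoid setoid

  Nonzero : Carrier → Set
  Nonzero x = ¬ x ≈ 0#

  IsInverse : (Carrier → Carrier) → Set
  IsInverse _⁻¹ = ∀ x → Nonzero x → x * (x ⁻¹) ≈ 1#

  -- Division by `x` through another representative `x′` of it, for which an explicit inverse `i` is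
  -- at hand.
  quotient-unique : ∀ x y x′ z i → x * y ≈ z → x ≈ x′ → x′ * i ≈ 1# → y ≈ z * i
  quotient-unique x y x′ z i xy≈z x≈x′ x′i≈1 = begin
    y               ≈⟨ *-identityʳ y ⟨
    y * 1#          ≈⟨ *-congˡ x′i≈1 ⟨
    y * (x′ * i)    ≈⟨ *-assoc y x′ i ⟨
    y * x′ * i      ≈⟨ *-congʳ (trans (*-comm y x′) (*-congʳ (sym x≈x′))) ⟩
    x * y * i       ≈⟨ *-congʳ xy≈z ⟩
    z * i           ∎

-- Algebra in an abstract field of characteristic zero with a nonzero element m

module FunctionField
  (R : CommutativeRing 0ℓ 0ℓ)
  (_⁻¹ : CommutativeRing.Carrier R → CommutativeRing.Carrier R)
  (*-inverseʳ : IsInverse R _⁻¹)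
  (morphism : ℤ.+-*-rawRing -Raw-AlmostCommutative⟶ fromCommutativeRing R)
  (#≉0 : ∀ n → Nonzero R (_-Raw-AlmostCommutative⟶_.⟦_⟧ morphism (ℤ.+ suc n)))
  (m : CommutativeRing.Carrier R) (m≉0 : Nonzero R m)
  where

  open CommutativeRing R public
    using (_≈_; _+_; _*_; -_; 0#; 1#; setoid; refl; sym; trans; +-cong; *-cong; -‿cong; semiring;
           *-congˡ; *-identityˡ; *-identityʳ; *-assoc; *-comm; +-assoc; +-identityʳ; zeroʳ)
    renaming (Carrier to K)

  open import Algebra.Properties.Semiring.Exp semiring public using (_^_)
  open _-Raw-AlmostCommutative⟶_ morphism public using () renaming (⟦_⟧ to fromℤ)
  open import Relation.Binary.Reasoning.Setoid setoid

  private module fromℤ = _-Raw-AlmostCommutative⟶_ morphism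

  infix  4 _≉_
  infixl 6 _-_
  infixl 7 _/_
  infix  9 #_

  _≉_ : K → K → Set
  x ≉ y = ¬ x ≈ y

  _-_ _/_ : K → K → K
  x - y = x + - y
  x / y = x * (y ⁻¹)

  #_ : ℕ → K
  # n = fromℤ (ℤ.+ n)

  private
    -- Coefficients are compared as integers only, so the solver never has to decide equality in the
    -- field.
    _coeff≟_ : WeaklyDecidable (λ i j → fromℤ i ≈ fromℤ j)
    i coeff≟ j with i ℤₚ.≟ j
    ... | yes ≡.refl = just refl
    ... | no _       = nothing

  open Algebra.Solver.Ring ℤ.+-*-rawRing (fromCommutativeRing R) morphism _coeff≟_ public
    using (Polynomial; op; var; con; solve; _:=_; _:+_; _:*_; _:-_; :-_; _:^_; ⟦_⟧; [+]; [*])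

  infix 10 :#_
  :#_ : ∀ {n} → ℕ → Polynomial n
  :# k = con (ℤ.+ k)

  :D : ∀ {n} → Polynomial n → Polynomial n
  :D m = m :^ 2 :+ :# 1

  D : K
  D = m ^ 2 + # 1

  1≉0 : 1# ≉ 0#
  1≉0 1≈0 = #≉0 0 (trans fromℤ.1-homo 1≈0)

  x-y≈0⇒x≈y : ∀ x y → x - y ≈ 0# → x ≈ y
  x-y≈0⇒x≈y x y e = begin
    x            ≈⟨ solve 2 (λ x y → x := (x :- y) :+ y) refl x y ⟩
    x - y + y    ≈⟨ +-cong e refl ⟩
    0# + y       ≈⟨ CommutativeRing.+-identityˡ R y ⟩
    y            ∎

  x≈y⇒x-y≈0 : ∀ {x y} → x ≈ y → x - y ≈ 0#
  x≈y⇒x-y≈0 {x} {y} e = trans (+-cong e refl) (CommutativeRing.-‿inverseʳ R y)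

  *-difference≈0 : ∀ c {x y} → x ≈ y → c * (x - y) ≈ 0#
  *-difference≈0 c e = trans (*-congˡ (x≈y⇒x-y≈0 e)) (zeroʳ c)

  private
    0+0 : ∀ {x y} → x ≈ 0# → y ≈ 0# → x + y ≈ 0#
    0+0 p q = trans (+-cong p q) (CommutativeRing.+-identityˡ R 0#)

  -- The last hypothesis, for given cofactors c, is an identity for the ring solver.
  combine₁ : ∀ {l r x y} c → x ≈ y → l - r ≈ c * (x - y) → l ≈ r
  combine₁ c e id = x-y≈0⇒x≈y _ _ (trans id (*-difference≈0 c e))

  combine₂ : ∀ {l r x y x′ y′} c c′ → x ≈ y → x′ ≈ y′ →
             l - r ≈ c * (x - y) + c′ * (x′ - y′) → l ≈ r
  combine₂ c c′ e e′ id = x-y≈0⇒x≈y _ _ (trans id (0+0 (*-difference≈0 c e) (*-difference≈0 c′ e′)))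

  combine₃ : ∀ {l r x y x′ y′ x″ y″} c c′ c″ → x ≈ y → x′ ≈ y′ → x″ ≈ y″ →
             l - r ≈ c * (x - y) + c′ * (x′ - y′) + c″ * (x″ - y″) → l ≈ r
  combine₃ c c′ c″ e e′ e″ id =
    x-y≈0⇒x≈y _ _ (trans id (0+0 (0+0 (*-difference≈0 c e) (*-difference≈0 c′ e′)) (*-difference≈0 c″ e″)))

  *-cancelˡ-0 : ∀ {a b} → a ≉ 0# → a * b ≈ 0# → b ≈ 0#
  *-cancelˡ-0 {a} {b} a≉0 ab≈0 = begin
    b                   ≈⟨ *-identityˡ b ⟨
    1# * b              ≈⟨ *-cong (*-inverseʳ a a≉0) refl ⟨
    a * (a ⁻¹) * b      ≈⟨ solve 3 (λ a i b → a :* i :* b := i :* (a :* b)) refl a (a ⁻¹) b ⟩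
    (a ⁻¹) * (a * b)    ≈⟨ *-congˡ ab≈0 ⟩
    (a ⁻¹) * 0#         ≈⟨ zeroʳ (a ⁻¹) ⟩
    0#                  ∎

  *-cancelˡ : ∀ {a x y} → a ≉ 0# → a * x ≈ a * y → x ≈ y
  *-cancelˡ {a} {x} {y} a≉0 ax≈ay = x-y≈0⇒x≈y x y (*-cancelˡ-0 a≉0 (trans
    (solve 3 (λ a x y → a :* (x :- y) := a :* x :- a :* y) refl a x y)
    (x≈y⇒x-y≈0 ax≈ay)))

  *-≉0 : ∀ {a b} → a ≉ 0# → b ≉ 0# → a * b ≉ 0#
  *-≉0 a≉0 b≉0 ab≈0 = b≉0 (*-cancelˡ-0 a≉0 ab≈0)

  ^-≉0 : ∀ {a} n → a ≉ 0# → a ^ n ≉ 0#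
  ^-≉0 zero    a≉0 = 1≉0
  ^-≉0 (suc n) a≉0 = *-≉0 a≉0 (^-≉0 n a≉0)

  *-/-cancel : ∀ a {b} → b ≉ 0# → b * (a / b) ≈ a
  *-/-cancel a {b} b≉0 = begin
    b * (a * (b ⁻¹))    ≈⟨ solve 3 (λ a b i → b :* (a :* i) := (b :* i) :* a) refl a b (b ⁻¹) ⟩
    b * (b ⁻¹) * a      ≈⟨ *-cong (*-inverseʳ b b≉0) refl ⟩
    1# * a              ≈⟨ *-identityˡ a ⟩
    a                   ∎

  -- The form with `# 1`, which is a coefficient for the solver, instead of `1#`.
  *-inverse : ∀ {a} → a ≉ 0# → a * (a ⁻¹) ≈ # 1
  *-inverse {a} a≉0 = trans (*-inverseʳ a a≉0) (sym fromℤ.1-homo)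

  -- Chords and tangents

  module Addition (α β : K) where

    -- On the line y = l (x - x₁) + y₁ the equation of the curve is x - x₁ times a quadratic
    -- polynomial in x, whose value at x₂ is assumed to vanish.
    chordPoint : ∀ l x₁ y₁ x₂ → y₁ ^ 2 ≈ x₁ ^ 3 + α * x₁ + β →
      x₂ ^ 2 + x₂ * x₁ + x₁ ^ 2 + α - l ^ 2 * (x₂ - x₁) - # 2 * l * y₁ ≈ # 0 →
      let x₃ = l ^ 2 - x₁ - x₂ in
      (l * (x₁ - x₃) - y₁) ^ 2 ≈ x₃ ^ 3 + α * x₃ + β
    chordPoint l x₁ y₁ x₂ e g =
      combine₂ (# 1) (x₁ - (l ^ 2 - x₁ - x₂)) e g
        (solve 6 (λ l x₁ y₁ x₂ α β →
          let x₃ = l :^ 2 :- x₁ :- x₂ in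
          (l :* (x₁ :- x₃) :- y₁) :^ 2 :- (x₃ :^ 3 :+ α :* x₃ :+ β)
          := :# 1 :* (y₁ :^ 2 :- (x₁ :^ 3 :+ α :* x₁ :+ β))
             :+ (x₁ :- x₃) :* (x₂ :^ 2 :+ x₂ :* x₁ :+ x₁ :^ 2 :+ α :- l :^ 2 :* (x₂ :- x₁) :- :# 2 :* l :* y₁ :- :# 0))
         refl l x₁ y₁ x₂ α β)

    -- Modulo the slope equation, the difference of the two curve equations is `x₂ - x₁` times the
    -- quadratic of `chordPoint`; the nonzero factor cancels.
    chordPoint-onCurve : ∀ l x₁ y₁ x₂ y₂ → y₁ ^ 2 ≈ x₁ ^ 3 + α * x₁ + β → y₂ ^ 2 ≈ x₂ ^ 3 + α * x₂ + β →
      x₂ - x₁ ≉ 0# → l * (x₂ - x₁) ≈ y₂ - y₁ →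
      let x₃ = l ^ 2 - x₁ - x₂ in
      (l * (x₁ - x₃) - y₁) ^ 2 ≈ x₃ ^ 3 + α * x₃ + β
    chordPoint-onCurve l x₁ y₁ x₂ y₂ e₁ e₂ x₂-x₁≉0 slope = chordPoint l x₁ y₁ x₂ e₁
      (*-cancelˡ x₂-x₁≉0 (combine₃ (# 1) (- # 1) (- (l * (x₂ - x₁) + y₁ + y₂)) e₁ e₂ slope
        (solve 7 (λ l x₁ y₁ x₂ y₂ α β →
            (x₂ :- x₁) :* (x₂ :^ 2 :+ x₂ :* x₁ :+ x₁ :^ 2 :+ α :- l :^ 2 :* (x₂ :- x₁) :- :# 2 :* l :* y₁)
            :- (x₂ :- x₁) :* :# 0
            := :# 1 :* (y₁ :^ 2 :- (x₁ :^ 3 :+ α :* x₁ :+ β))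
               :+ (:- :# 1) :* (y₂ :^ 2 :- (x₂ :^ 3 :+ α :* x₂ :+ β))
               :+ (:- (l :* (x₂ :- x₁) :+ y₁ :+ y₂)) :* (l :* (x₂ :- x₁) :- (y₂ :- y₁)))
          refl l x₁ y₁ x₂ y₂ α β)))

    -- At `x₂ = x₁` the quadratic takes the value `3 x₁² + α - 2 l y₁`, so its vanishing is the
    -- slope equation itself.
    tangentPoint-onCurve : ∀ l x₁ y₁ → y₁ ^ 2 ≈ x₁ ^ 3 + α * x₁ + β →
      l * (# 2 * y₁) ≈ # 3 * x₁ ^ 2 + α →
      let x₃ = l ^ 2 - x₁ - x₁ in
      (l * (x₁ - x₃) - y₁) ^ 2 ≈ x₃ ^ 3 + α * x₃ + β
    tangentPoint-onCurve l x₁ y₁ e₁ slope = chordPoint l x₁ y₁ x₁ e₁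
      (combine₁ (- # 1) slope
        (solve 4 (λ l x₁ y₁ α →
            x₁ :^ 2 :+ x₁ :* x₁ :+ x₁ :^ 2 :+ α :- l :^ 2 :* (x₁ :- x₁) :- :# 2 :* l :* y₁ :- :# 0
            := (:- :# 1) :* (l :* (:# 2 :* y₁) :- (:# 3 :* x₁ :^ 2 :+ α)))
          refl l x₁ y₁ α))

  -- The birational transformation between the cubic and the quartic

  T : K → K
  T X = X + # 12 * (m ^ 4 - # 1)

  W : K → K
  W U = U ^ 2 - # 2 * D * U + D

  excluded : K
  excluded = # 12 * D * (# 2 * m ^ 2 + # 1)

  α β : K
  α = - (# 432 * (m ^ 4 - # 2 * m ^ 2 - # 2) * D ^ 2)
  β = - (# 1728 * (m ^ 2 - # 1) * D ^ 3 * (# 2 * m ^ 4 - # 4 * m ^ 2 - # 7))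

  toU-num : K → K → K
  toU-num X Y = m * Y + # 6 * D * X + # 72 * D ^ 2 * (m ^ 2 - # 1)

  -- At a zero U of quadraticU, a quadratic polynomial in U, this is 54 times a square root
  -- of its quarter discriminant.
  root : K → K → K
  root U Z = # 54 * ((# 2 * Z - # 4 * D * m ^ 4) * U - # 2 * D * Z)

  -- The quadratic in `U` left after eliminating `V`. It equals `W² - 4 D m⁴ U² - V²` for
  -- `V = Z - W`, so its vanishing is the quartic equation.
  quadraticU : K → K → K
  quadraticU U Z = # 2 * Z * W U - # 4 * D * m ^ 4 * U ^ 2 - Z ^ 2

  private
    -- Solver syntax that evaluates to the functions of the corresponding names.
    module Poly {n} (m : Polynomial n) where
      :T :W : Polynomial n → Polynomial n
      :T X = X :+ :# 12 :* (m :^ 4 :- :# 1)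
      :W U = U :^ 2 :- :# 2 :* :D m :* U :+ :D m
      :excl :α :β : Polynomial n
      :excl = :# 12 :* :D m :* (:# 2 :* m :^ 2 :+ :# 1)
      :α = :- (:# 432 :* (m :^ 4 :- :# 2 :* m :^ 2 :- :# 2) :* :D m :^ 2)
      :β = :- (:# 1728 :* (m :^ 2 :- :# 1) :* :D m :^ 3 :* (:# 2 :* m :^ 4 :- :# 4 :* m :^ 2 :- :# 7))
      :num :root :q : Polynomial n → Polynomial n → Polynomial n
      :num X Y = m :* Y :+ :# 6 :* :D m :* X :+ :# 72 :* :D m :^ 2 :* (m :^ 2 :- :# 1)
      :root U Z = :# 54 :* ((:# 2 :* Z :- :# 4 :* :D m :* m :^ 4) :* U :- :# 2 :* :D m :* Z)
      :q U Z = :# 2 :* Z :* :W U :- :# 4 :* :D m :* m :^ 4 :* U :^ 2 :- Z :^ 2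
      :cof : Polynomial n → Polynomial n → Polynomial n
      :cof X Z = (:# 18 :* Z) :^ 2 :+ :# 18 :* Z :* (m :^ 2 :* :T X) :+ (m :^ 2 :* :T X) :^ 2
           :+ :# 36 :* :D m :* m :^ 2 :* (:# 1 :- m :^ 2) :* (:# 18 :* Z :+ m :^ 2 :* :T X)
           :+ :# 1296 :* :D m :^ 2 :* m :^ 4

  -- The divided difference, at A = `18 Z` and A = `m² T X`, of the cubic A³ + 36 D m² (1 - m²) A² +
  -- 1296 D² m⁴ A, whose value at `m² T X` is `m⁶ rhs X`. It moves the curve equation from `X` to
  -- `Z`.
  cofactor : K → K → K
  cofactor X Z = (# 18 * Z) ^ 2 + # 18 * Z * (m ^ 2 * T X) + (m ^ 2 * T X) ^ 2
           + # 36 * D * m ^ 2 * (# 1 - m ^ 2) * (# 18 * Z + m ^ 2 * T X)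
           + # 1296 * D ^ 2 * m ^ 4

  -- Under `18 Z = m² T X` the equation `root U Z = m³ Y` is `m²` times a linear equation for `U`.
  -- Its coefficients are the origin of `excluded` and `toU-num`.
  root-identity : ∀ X Y U Z →
    root U Z - m ^ 3 * Y
    ≈ (# 6 * U - # 6 * D) * (# 18 * Z - m ^ 2 * T X)
      + m ^ 2 * (# 6 * (X - excluded) * U - toU-num X Y)
  root-identity X Y U Z = solve 5 (λ m X Y U Z → let open Poly m in
      :root U Z :- m :^ 3 :* Y
      := (:# 6 :* U :- :# 6 :* :D m) :* (:# 18 :* Z :- m :^ 2 :* :T X)
         :+ m :^ 2 :* (:# 6 :* (X :- :excl) :* U :- :num X Y))
    refl m X Y U Z

  rhs : K → K
  rhs X = X ^ 3 + α * X + β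

  root≈ : ∀ X Y U Z → # 18 * Z ≈ m ^ 2 * T X → # 6 * (X - excluded) * U ≈ toU-num X Y →
          root U Z ≈ m ^ 3 * Y
  root≈ X Y U Z hZ hU = combine₂ (# 6 * U - # 6 * D) (m ^ 2) hZ hU (root-identity X Y U Z)

  -- Completing the square: `2916 (2 Z - 4 D m⁴)` times the quadratic is `root²` minus the cubic of
  -- `cofactor` at `18 Z`, which becomes `m⁶ Y² - m⁶ rhs X`. The factor becomes
  -- `324 m² (X - excluded)` and is cancelled.
  quadraticU≈0 : ∀ X Y U Z → # 18 * Z ≈ m ^ 2 * T X → X ≉ excluded → root U Z ≈ m ^ 3 * Y →
                 Y ^ 2 ≈ rhs X → quadraticU U Z ≈ # 0
  quadraticU≈0 X Y U Z hZ X≉ r≈ onCurve =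
    -- `#≉0 n` speaks of the constant `suc n`, here 324.
    *-cancelˡ (*-≉0 (*-≉0 (#≉0 323) (^-≉0 2 m≉0)) (λ e → X≉ (x-y≈0⇒x≈y X excluded e)))
      (combine₃ (m ^ 6) (root U Z + m ^ 3 * Y) (- cofactor X Z - # 324 * quadraticU U Z) onCurve r≈ hZ
        (solve 5 (λ m X Y U Z → let open Poly m in
            :# 324 :* m :^ 2 :* (X :- :excl) :* :q U Z :- :# 324 :* m :^ 2 :* (X :- :excl) :* :# 0
            := m :^ 6 :* (Y :^ 2 :- (X :^ 3 :+ :α :* X :+ :β))
               :+ (:root U Z :+ m :^ 3 :* Y) :* (:root U Z :- m :^ 3 :* Y)
               :+ (:- :cof X Z :- :# 324 :* :q U Z) :* (:# 18 :* Z :- m :^ 2 :* :T X))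
          refl m X Y U Z))

  OnQuartic : K → K → Set
  OnQuartic U V = V ^ 2 ≈ U ^ 4 - # 4 * D * U ^ 3
        - # 2 * D * (# 2 * m ^ 4 - # 2 * m ^ 2 - # 3) * U ^ 2
        - # 4 * D ^ 2 * U + D ^ 2

  private
    :quartic : ∀ {n} → Polynomial n → Polynomial n → Polynomial n
    :quartic m U = U :^ 4 :- :# 4 :* :D m :* U :^ 3
        :- :# 2 :* :D m :* (:# 2 :* m :^ 4 :- :# 2 :* m :^ 2 :- :# 3) :* U :^ 2
        :- :# 4 :* :D m :^ 2 :* U :+ :D m :^ 2

  quadraticU⇒quartic : ∀ U Z → quadraticU U Z ≈ # 0 → OnQuartic U (Z - W U)
  quadraticU⇒quartic U Z q≈0 = combine₁ (- # 1) q≈0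
    (solve 3 (λ m U Z → let open Poly m in
        (Z :- :W U) :^ 2 :- :quartic m U := (:- :# 1) :* (:q U Z :- :# 0))
      refl m U Z)

  quartic⇒quadraticU : ∀ U V → OnQuartic U V → quadraticU U (V + U ^ 2 - # 2 * D * U + D) ≈ # 0
  quartic⇒quadraticU U V onQuartic = combine₁ (- # 1) onQuartic
    (solve 3 (λ m U V → let open Poly m in
        :q U (V :+ U :^ 2 :- :# 2 :* :D m :* U :+ :D m) :- :# 0 := (:- :# 1) :* (V :^ 2 :- :quartic m U))
      refl m U V)

  toU toV fromX fromY : K → K → K
  toU X Y = toU-num X Y / (# 6 * (X - excluded))
  toV X Y = m ^ 2 * (X + # 12 * (m ^ 4 - # 1)) / # 18 - W (toU X Y)

  Z′ : K → K → K
  Z′ U V = V + U ^ 2 - # 2 * D * U + D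

  fromX U V = # 18 * Z′ U V / m ^ 2 - # 12 * (m ^ 4 - # 1)
  fromY U V = # 108 * (U * (Z′ U V - # 2 * D * m ^ 4) - D * Z′ U V) / m ^ 3

  module Forward (X Y : K) (onCurve : Y ^ 2 ≈ rhs X) (X≉ : X ≉ excluded) where
    private
      U = toU X Y
      V = toV X Y
      Z = m ^ 2 * T X / # 18

      d≉0 : # 6 * (X - excluded) ≉ 0#
      d≉0 = *-≉0 (#≉0 5) (λ e → X≉ (x-y≈0⇒x≈y X excluded e))

      hZ : # 18 * Z ≈ m ^ 2 * T X
      hZ = *-/-cancel (m ^ 2 * T X) (#≉0 17)

      hU : # 6 * (X - excluded) * U ≈ toU-num X Y
      hU = *-/-cancel (toU-num X Y) d≉0

      r≈ : root U Z ≈ m ^ 3 * Y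
      r≈ = root≈ X Y U Z hZ hU

      q≈0 : quadraticU U Z ≈ # 0
      q≈0 = quadraticU≈0 X Y U Z hZ X≉ r≈ onCurve

    onQuartic : OnQuartic U V
    onQuartic = quadraticU⇒quartic U Z q≈0

    fromX-toUV : fromX U V ≈ X
    fromX-toUV = *-cancelˡ (^-≉0 2 m≉0) (combine₂ (# 1) (# 1) (*-/-cancel (# 18 * Z′ U V) (^-≉0 2 m≉0)) hZ
      (solve 5 (λ m X U Z w → let open Poly m
                                  Z′ = Z :- :W U :+ U :^ 2 :- :# 2 :* :D m :* U :+ :D m in
          m :^ 2 :* (w :- :# 12 :* (m :^ 4 :- :# 1)) :- m :^ 2 :* X
          := :# 1 :* (m :^ 2 :* w :- :# 18 :* Z′) :+ :# 1 :* (:# 18 :* Z :- m :^ 2 :* :T X))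
        refl m X U Z (# 18 * Z′ U V / m ^ 2)))

    fromY-toUV : fromY U V ≈ Y
    fromY-toUV = *-cancelˡ (^-≉0 3 m≉0) (trans (*-/-cancel _ (^-≉0 3 m≉0)) (trans
      (solve 3 (λ m U Z → let open Poly m
                              Z′ = Z :- :W U :+ U :^ 2 :- :# 2 :* :D m :* U :+ :D m in
          :# 108 :* (U :* (Z′ :- :# 2 :* :D m :* m :^ 4) :- :D m :* Z′) := :root U Z)
        refl m U Z) r≈))

  module Backward (U V : K) (onQuartic : OnQuartic U V) where
    private
      X = fromX U V
      Y = fromY U V
      Z = Z′ U V

      hZ : # 18 * Z ≈ m ^ 2 * T X
      hZ = combine₁ (- # 1) (*-/-cancel (# 18 * Z) (^-≉0 2 m≉0))
        (solve 3 (λ m Z w → let open Poly m in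
            :# 18 :* Z :- m :^ 2 :* :T (w :- :# 12 :* (m :^ 4 :- :# 1)) := (:- :# 1) :* (m :^ 2 :* w :- :# 18 :* Z))
          refl m Z (# 18 * Z / m ^ 2))

      r≈ : root U Z ≈ m ^ 3 * Y
      r≈ = trans (solve 3 (λ m U Z → let open Poly m in
             :root U Z := :# 108 :* (U :* (Z :- :# 2 :* :D m :* m :^ 4) :- :D m :* Z)) refl m U Z)
           (sym (*-/-cancel _ (^-≉0 3 m≉0)))

      q≈0 : quadraticU U Z ≈ # 0
      q≈0 = quartic⇒quadraticU U V onQuartic

    -- The completed square read in the other direction: once the quadratic vanishes, `root²` is the
    -- cubic at `18 Z`, which is `m⁶ rhs X`.
    onCurve : Y ^ 2 ≈ rhs X
    onCurve = *-cancelˡ (^-≉0 6 m≉0)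
      (combine₃ (- (root U Z + m ^ 3 * Y)) (# 2916 * (# 2 * Z - # 4 * D * m ^ 4)) (cofactor X Z) r≈ q≈0 hZ
        (solve 5 (λ m X Y U Z → let open Poly m in
            m :^ 6 :* Y :^ 2 :- m :^ 6 :* (X :^ 3 :+ :α :* X :+ :β)
            := (:- (:root U Z :+ m :^ 3 :* Y)) :* (:root U Z :- m :^ 3 :* Y)
               :+ :# 2916 :* (:# 2 :* Z :- :# 4 :* :D m :* m :^ 4) :* (:q U Z :- :# 0)
               :+ :cof X Z :* (:# 18 :* Z :- m :^ 2 :* :T X))
          refl m X Y U Z))

    module _ (X≉ : X ≉ excluded) where
      private
        d≉0 : # 6 * (X - excluded) ≉ 0#
        d≉0 = *-≉0 (#≉0 5) (λ e → X≉ (x-y≈0⇒x≈y X excluded e))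

      -- `U` and `toU X Y` solve the same linear equation, by the identity of `root-identity`.
      toU-fromXY : toU X Y ≈ U
      toU-fromXY = *-cancelˡ d≉0 (trans (*-/-cancel (toU-num X Y) d≉0)
        (*-cancelˡ (^-≉0 2 m≉0) (combine₂ (# 6 * U - # 6 * D) (- # 1) hZ r≈
          (solve 5 (λ m X Y U Z → let open Poly m in
              m :^ 2 :* :num X Y :- m :^ 2 :* (:# 6 :* (X :- :excl) :* U)
              := (:# 6 :* U :- :# 6 :* :D m) :* (:# 18 :* Z :- m :^ 2 :* :T X)
                 :+ (:- :# 1) :* (:root U Z :- m :^ 3 :* Y))
            refl m X Y U Z))))

      toV-fromXY : toV X Y ≈ V
      -- The second cofactor comes from `W U′ - W U = (U′ + U - 2 D) (U′ - U)`.
      toV-fromXY = combine₂ (# 1) (- (toU X Y + U - # 2 * D)) hZ″ toU-fromXY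
        (solve 5 (λ m U V U′ Z″ → let open Poly m in
            Z″ :- :W U′ :- V
            := :# 1 :* (Z″ :- (V :+ U :^ 2 :- :# 2 :* :D m :* U :+ :D m))
               :+ (:- (U′ :+ U :- :# 2 :* :D m)) :* (U′ :- U))
          refl m U V (toU X Y) (m ^ 2 * T X / # 18))
        where
        hZ″ : m ^ 2 * T X / # 18 ≈ Z
        hZ″ = *-cancelˡ (#≉0 17) (trans (*-/-cancel (m ^ 2 * T X) (#≉0 17)) (sym hZ))

  -- The diophantine equation and the triples

  module Diophantine (s : K) (s≉0 : s ≉ 0#) (U V : K) (onQuartic : OnQuartic U V) where
    -- The equation is `s⁴` times the quartic. The two inverses are unknowns i and j for the solver,
    -- with `s i = 1` and `s⁴ j = 1` as side conditions.
    diophantine : let t = m * s ; u = s * U ; v = s ^ 2 * V in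
      v ^ 2 ≈ u ^ 4 - # 4 * (s ^ 2 + t ^ 2) / s * u ^ 3
              + # 2 * (s ^ 2 + t ^ 2)
                    * (# 3 * s ^ 4 + # 2 * s ^ 2 * t ^ 2 - # 2 * t ^ 4) / s ^ 4
                    * u ^ 2
              - # 4 * (s ^ 2 + t ^ 2) ^ 2 / s * u
              + (s ^ 2 + t ^ 2) ^ 2
    diophantine = combine₃ (s ^ 4) (# 4 * D * s ^ 4 * U ^ 3 + # 4 * D ^ 2 * s ^ 4 * U)
        (- (# 2 * D * (# 3 + # 2 * m ^ 2 - # 2 * m ^ 4) * s ^ 4 * U ^ 2))
        onQuartic (*-inverse s≉0) (*-inverse (^-≉0 4 s≉0))
        (solve 6 (λ m s U V i j → let t = m :* s ; u = s :* U ; v = s :^ 2 :* V in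
            v :^ 2 :- (u :^ 4 :- :# 4 :* (s :^ 2 :+ t :^ 2) :* i :* u :^ 3
              :+ :# 2 :* (s :^ 2 :+ t :^ 2)
                    :* (:# 3 :* s :^ 4 :+ :# 2 :* s :^ 2 :* t :^ 2 :- :# 2 :* t :^ 4) :* j
                    :* u :^ 2
              :- :# 4 :* (s :^ 2 :+ t :^ 2) :^ 2 :* i :* u
              :+ (s :^ 2 :+ t :^ 2) :^ 2)
            := s :^ 4 :* (V :^ 2 :- :quartic m U)
               :+ (:# 4 :* :D m :* s :^ 4 :* U :^ 3 :+ :# 4 :* :D m :^ 2 :* s :^ 4 :* U) :* (s :* i :- :# 1)
               :+ (:- (:# 2 :* :D m :* (:# 3 :+ :# 2 :* m :^ 2 :- :# 2 :* m :^ 4) :* s :^ 4 :* U :^ 2)) :* (s :^ 4 :* j :- :# 1))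
          refl m s U V (s ⁻¹) ((s ^ 4) ⁻¹))

  module Triple (U V e : K) (onQuartic : OnQuartic U V) where
    -- `(2 m e)²` times the triple D, (W + V) / (2 m²), (W - V) / (2 m²), written with a = `e U` and
    -- b = `e V`; `:p`, `:q`, `:r` are the roots of its symmetric functions. As syntax with integer
    -- coefficients they show integrality as soon as `e U`, `e V` and `e` are integral.
    :f : Vector (Polynomial 4) 3
    :f i = let m = var 0F ; a = var 1F ; b = var 2F ; e = var 3F in
      lookup (:# 4 :* m :^ 2 :* e :^ 2 :* :D m
               ∷ :# 2 :* (a :^ 2 :- :# 2 :* :D m :* a :* e :+ :D m :* e :^ 2 :+ b :* e)
               ∷ :# 2 :* (a :^ 2 :- :# 2 :* :D m :* a :* e :+ :D m :* e :^ 2 :- b :* e) ∷ []) i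
    :p :q :r : Polynomial 4
    :p = let m = var 0F ; a = var 1F ; e = var 3F in :# 2 :* (e :* :D m :- a)
    :q = let m = var 0F ; a = var 1F ; e = var 3F in :# 4 :* m :* e :* :D m :* (a :- e)
    :r = let m = var 0F ; a = var 1F ; e = var 3F in :# 8 :* m :^ 3 :* e :^ 2 :* a :* :D m

    env : Vec K 4
    env = m ∷ e * U ∷ e * V ∷ e ∷ []

    f : Vector K 3
    f i = ⟦ :f i ⟧ env

    p q r : K
    p = ⟦ :p ⟧ env
    q = ⟦ :q ⟧ env
    r = ⟦ :r ⟧ env

    private
      -- The same expressions with a and b expanded, so that the quartic equation in `U` and `V` can
      -- be applied to them.
      module F {n} (m U V e : Polynomial n) where
        :f₀ :f₁ :f₂ :p′ :q′ :r′ a b : Polynomial n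
        a = e :* U
        b = e :* V
        :f₀ = :# 4 :* m :^ 2 :* e :^ 2 :* :D m
        :f₁ = :# 2 :* (a :^ 2 :- :# 2 :* :D m :* a :* e :+ :D m :* e :^ 2 :+ b :* e)
        :f₂ = :# 2 :* (a :^ 2 :- :# 2 :* :D m :* a :* e :+ :D m :* e :^ 2 :- b :* e)
        :p′ = :# 2 :* (e :* :D m :- a)
        :q′ = :# 4 :* m :* e :* :D m :* (a :- e)
        :r′ = :# 8 :* m :^ 3 :* e :^ 2 :* a :* :D m

    -- Up to scaling this is `m² D + W = (D - U)²`, which holds because `m² + 1 = D`.
    e₁-square : f 0F + f 1F + f 2F ≈ p * p
    e₁-square = solve 4 (λ m U V e → let open F m U V e in :f₀ :+ :f₁ :+ :f₂ := :p′ :* :p′) refl m U V e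

    -- `V` enters only through the product of the last two entries, where the quartic gives
    -- `W² - V² = 4 D m⁴ U²`; what remains is `D (W + m² U²) = D² (U - 1)²` up to scaling.
    e₂-square : f 0F * f 1F + f 1F * f 2F + f 2F * f 0F ≈ q * q
    e₂-square = combine₁ (- (# 4 * e ^ 4)) onQuartic
      (solve 4 (λ m U V e → let open F m U V e in
          :f₀ :* :f₁ :+ :f₁ :* :f₂ :+ :f₂ :* :f₀ :- :q′ :* :q′ := (:- (:# 4 :* e :^ 4)) :* (V :^ 2 :- :quartic m U))
        refl m U V e)

    e₃-square : f 0F * f 1F * f 2F ≈ r * r
    e₃-square = combine₁ (- (# 16 * m ^ 2 * e ^ 6 * D)) onQuartic
      (solve 4 (λ m U V e → let open F m U V e in
          :f₀ :* :f₁ :* :f₂ :- :r′ :* :r′ := (:- (:# 16 :* m :^ 2 :* e :^ 6 :* :D m)) :* (V :^ 2 :- :quartic m U))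
        refl m U V e)

    module Scaled (e≉0 : e ≉ 0#) (s : K) (s≉0 : s ≉ 0#) where
      -- `f` is `(2 m e)²` times the normalised triple, whereas `s² + t²` and the roots are `s²`
      -- times it; hence the quotient by `s`.
      g x₁ x₂ : K
      g = # 2 * m * e / s
      x₁ = f 1F / g ^ 2
      x₂ = f 2F / g ^ 2

      g≉0 : g ≉ 0#
      g≉0 = *-≉0 (*-≉0 (*-≉0 (#≉0 1) m≉0) e≉0) (λ s⁻¹≈0 → 1≉0 (trans (sym (*-inverseʳ s s≉0)) (trans (*-congˡ s⁻¹≈0) (zeroʳ s))))

      f₀≈ : f 0F ≈ g ^ 2 * (s ^ 2 + (m * s) ^ 2)
      f₀≈ = combine₁ (- (# 4 * m ^ 2 * e ^ 2 * D * (s * (s ⁻¹) + # 1))) (*-inverse s≉0)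
        (solve 6 (λ m U V e s i → let open F m U V e in
            :f₀ :- (:# 2 :* m :* e :* i) :^ 2 :* (s :^ 2 :+ (m :* s) :^ 2)
            := (:- (:# 4 :* m :^ 2 :* e :^ 2 :* :D m :* (s :* i :+ :# 1))) :* (s :* i :- :# 1))
          refl m U V e s (s ⁻¹))

      f₁≈ : f 1F ≈ g ^ 2 * x₁
      f₁≈ = sym (*-/-cancel (f 1F) (^-≉0 2 g≉0))

      f₂≈ : f 2F ≈ g ^ 2 * x₂
      f₂≈ = sym (*-/-cancel (f 2F) (^-≉0 2 g≉0))

      quadraticIn : K → K
      quadraticIn x = let t = m * s ; u = s * U in
        t ^ 2 * x ^ 2
        - s * (s ^ 3 - # 2 * s ^ 2 * u + s * t ^ 2 + s * u ^ 2 - # 2 * t ^ 2 * u) * x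
        + u ^ 2 * t ^ 2 * (s ^ 2 + t ^ 2)

      gs : g ^ 2 * s ^ 2 ≈ # 4 * m ^ 2 * e ^ 2
      gs = combine₁ (# 4 * m ^ 2 * e ^ 2 * (s * (s ⁻¹) + # 1)) (*-inverse s≉0)
        (solve 4 (λ m e s i →
            (:# 2 :* m :* e :* i) :^ 2 :* s :^ 2 :- :# 4 :* m :^ 2 :* e :^ 2
            := :# 4 :* m :^ 2 :* e :^ 2 :* (s :* i :+ :# 1) :* (s :* i :- :# 1))
          refl m e s (s ⁻¹))

      -- Vieta after multiplication by `g⁴`: the middle coefficient of the quadratic is `s⁴ W U`,
      -- matching `f 1F + f 2F = 4 e² W U`, and the quartic equation gives the product
      -- `f 1F * f 2F = 16 D m⁴ e⁴ U²`.
      roots : ∀ x → quadraticIn x ≈ (m * s) ^ 2 * ((x - x₁) * (x - x₂))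
      roots x = *-cancelˡ (^-≉0 2 (^-≉0 2 g≉0)) (trans expanded (sym factored))
        where
        γ = g ^ 2
        middle = (m * s) ^ 2 * ((γ * x - f 1F) * (γ * x - f 2F))
        expanded : γ ^ 2 * quadraticIn x ≈ middle
        expanded = combine₂ (# 4 * m ^ 2 * s ^ 2 * e ^ 4)
          (m ^ 2 * s ^ 2 * U ^ 2 * D * (γ * s ^ 2 + # 4 * m ^ 2 * e ^ 2) - γ * x * s ^ 2 * W U) onQuartic gs
          (solve 7 (λ m U V e s γ x → let open F m U V e ; t = m :* s ; u = s :* U in
            γ :^ 2 :* (t :^ 2 :* x :^ 2
              :- s :* (s :^ 3 :- :# 2 :* s :^ 2 :* u :+ s :* t :^ 2 :+ s :* u :^ 2 :- :# 2 :* t :^ 2 :* u) :* x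
              :+ u :^ 2 :* t :^ 2 :* (s :^ 2 :+ t :^ 2))
            :- t :^ 2 :* ((γ :* x :- :f₁) :* (γ :* x :- :f₂))
            := :# 4 :* m :^ 2 :* s :^ 2 :* e :^ 4 :* (V :^ 2 :- :quartic m U)
               :+ (m :^ 2 :* s :^ 2 :* U :^ 2 :* :D m :* (γ :* s :^ 2 :+ :# 4 :* m :^ 2 :* e :^ 2) :- γ :* x :* s :^ 2 :* Poly.:W m U)
                  :* (γ :* s :^ 2 :- :# 4 :* m :^ 2 :* e :^ 2))
           refl m U V e s γ x)
        factored : γ ^ 2 * ((m * s) ^ 2 * ((x - x₁) * (x - x₂))) ≈ middle
        factored = combine₂ ((m * s) ^ 2 * (γ * x - γ * x₂)) ((m * s) ^ 2 * (γ * x - f 1F)) f₁≈ f₂≈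
          (solve 7 (λ γ t x x₁ x₂ f₁ f₂ →
            γ :^ 2 :* (t :^ 2 :* ((x :- x₁) :* (x :- x₂))) :- t :^ 2 :* ((γ :* x :- f₁) :* (γ :* x :- f₂))
            := t :^ 2 :* (γ :* x :- γ :* x₂) :* (f₁ :- γ :* x₁) :+ t :^ 2 :* (γ :* x :- f₁) :* (f₂ :- γ :* x₂))
           refl γ (m * s) x x₁ x₂ (f 1F) (f 2F))

  -- Values at a place

  ⟦_⟧ℤ : ∀ {n} → Polynomial n → Vec ℤ n → ℤ
  ⟦ op [+] p q ⟧ℤ ρ = ⟦ p ⟧ℤ ρ ℤ.+ ⟦ q ⟧ℤ ρ
  ⟦ op [*] p q ⟧ℤ ρ = ⟦ p ⟧ℤ ρ ℤ.* ⟦ q ⟧ℤ ρ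
  ⟦ con c ⟧ℤ      ρ = c
  ⟦ var i ⟧ℤ      ρ = lookup ρ i
  ⟦ p :^ n ⟧ℤ     ρ = ⟦ p ⟧ℤ ρ ℤ.^ n
  ⟦ :- p ⟧ℤ       ρ = ℤ.- ⟦ p ⟧ℤ ρ

  -- Val x c: the function x is regular at m = k with value c.
  record Place (k : ℤ) : Set₁ where
    field
      Val        : K → ℤ → Set
      Val-≈      : ∀ {x y c} → x ≈ y → Val x c → Val y c
      Val-fromℤ  : ∀ i → Val (fromℤ i) i
      Val-m      : Val m k
      Val-+      : ∀ {x y c d} → Val x c → Val y d → Val (x + y) (c ℤ.+ d)
      Val-*      : ∀ {x y c d} → Val x c → Val y d → Val (x * y) (c ℤ.* d)
      Val-neg    : ∀ {x c} → Val x c → Val (- x) (ℤ.- c)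
      Val-unique : ∀ {x c d} → Val x c → Val x d → c ≡ d
      -- Division with the value `d` of the quotient proposed in advance, so that all values stay in
      -- ℤ.
      Val-cancel : ∀ {x y c d} → Val x c → c ≢ ℤ.0ℤ → Val (x * y) (c ℤ.* d) → Val y d

    Val-^ : ∀ {x c} → Val x c → ∀ n → Val (x ^ n) (c ℤ.^ n)
    Val-^ v zero    = Val-≈ fromℤ.1-homo (Val-fromℤ ℤ.1ℤ)
    Val-^ v (suc n) = Val-* v (Val-^ v n)

    Val-⟦⟧ : ∀ {n} (p : Polynomial n) {ρ σ} → Pointwise Val ρ σ → Val (⟦ p ⟧ ρ) (⟦ p ⟧ℤ σ)
    Val-⟦⟧ (op [+] p q) vs = Val-+ (Val-⟦⟧ p vs) (Val-⟦⟧ q vs)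
    Val-⟦⟧ (op [*] p q) vs = Val-* (Val-⟦⟧ p vs) (Val-⟦⟧ q vs)
    Val-⟦⟧ (con c)      vs = Val-fromℤ c
    Val-⟦⟧ (var i)      vs = Pw.lookup vs i
    Val-⟦⟧ (p :^ n)     vs = Val-^ (Val-⟦⟧ p vs) n
    Val-⟦⟧ (:- p)       vs = Val-neg (Val-⟦⟧ p vs)

    Val-0# : Val 0# ℤ.0ℤ
    Val-0# = Val-≈ fromℤ.0-homo (Val-fromℤ ℤ.0ℤ)

    Val⇒≉0 : ∀ {x c} → Val x c → c ≢ ℤ.0ℤ → x ≉ 0#
    Val⇒≉0 v c≢0 x≈0 = c≢0 (Val-unique v (Val-≈ (sym x≈0) Val-0#))

    Val-quotient : ∀ {x y z c d e} → Val x c → c ≢ ℤ.0ℤ → Val z e → x * y ≈ z → e ≡ c ℤ.* d → Val y d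
    Val-quotient vx c≢0 vz xy≈z ≡.refl = Val-cancel vx c≢0 (Val-≈ (sym xy≈z) vz)

  -- Leading terms at m = 0

  module AtZero (place : Place ℤ.0ℤ) where
    open Place place

    -- The leading terms of X and Y at m = 0 are 36 (ν m)⁻² and 216 (ν m)⁻³.
    record Leading (ν : ℤ) (X Y : K) : Set where
      constructor leading
      field
        X-val : Val (fromℤ ν ^ 2 * (m ^ 2 * X)) (ℤ.+ 36)
        Y-val : Val (fromℤ ν ^ 3 * (m ^ 3 * Y)) (ℤ.+ 216)

    -- The slope of the line through P and νP has the leading term
    -- 6 (1 + ν + ν²) / (ν (1 + ν) m).
    slope-val : ℤ → ℤ
    slope-val ν = ℤ.+ 6 ℤ.* (ℤ.1ℤ ℤ.+ ν ℤ.+ ν ℤ.^ 2)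

    module Sum (ν : ℤ) (ν≢0 : ν ≢ ℤ.0ℤ) {x₁ y₁ x₂ y₂ : K}
      (lead₁ : Leading ℤ.1ℤ x₁ y₁) (lead₂ : Leading ν x₂ y₂) where
      private
        n = fromℤ ν
        open Leading lead₁ renaming (X-val to X₁-val; Y-val to Y₁-val)
        open Leading lead₂ renaming (X-val to X₂-val; Y-val to Y₂-val)
        n-val : Val n ν
        n-val = Val-fromℤ ν
        -- The powers of `# 1` are the factors `fromℤ ν ^ 2` and `fromℤ ν ^ 3` of `Leading` at ν =
        -- 1.
        A₁ = # 1 ^ 2 * (m ^ 2 * x₁)
        B₁ = # 1 ^ 3 * (m ^ 3 * y₁)
        A₂ = n ^ 2 * (m ^ 2 * x₂)
        B₂ = n ^ 3 * (m ^ 3 * y₂)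

      -- The slope equation multiplied by `(1 + n) m³ n³`. At m = 0 it rests on (1 + ν) (1 - ν³) =
      -- (1 - ν²) (1 + ν + ν²), and the nonzero `36 - 36 ν²` says that the abscissae differ in their
      -- leading terms.
      chordSlope : ∀ l → ℤ.+ 36 ℤ.- ℤ.+ 36 ℤ.* ν ℤ.^ 2 ≢ ℤ.0ℤ → l * (x₂ - x₁) ≈ y₂ - y₁ →
        Val (n * (# 1 + n) * (m * l)) (slope-val ν)
      chordSlope l c≢0 e = Val-quotient
        (Val-⟦⟧ (let A₁ = var 0F ; A₂ = var 1F ; n = var 2F in A₂ :- A₁ :* n :^ 2)
           {A₁ ∷ A₂ ∷ n ∷ []} (X₁-val ∷ X₂-val ∷ n-val ∷ []))
        c≢0
        (Val-⟦⟧ (let B₁ = var 0F ; B₂ = var 1F ; n = var 2F in (:# 1 :+ n) :* (B₂ :- B₁ :* n :^ 3))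
           {B₁ ∷ B₂ ∷ n ∷ []} (Y₁-val ∷ Y₂-val ∷ n-val ∷ []))
        (combine₁ ((# 1 + n) * m ^ 3 * n ^ 3) e
          (solve 7 (λ m x₁ y₁ x₂ y₂ n l →
             (n :^ 2 :* (m :^ 2 :* x₂) :- :# 1 :^ 2 :* (m :^ 2 :* x₁) :* n :^ 2) :* (n :* (:# 1 :+ n) :* (m :* l))
             :- (:# 1 :+ n) :* (n :^ 3 :* (m :^ 3 :* y₂) :- :# 1 :^ 3 :* (m :^ 3 :* y₁) :* n :^ 3)
             := (:# 1 :+ n) :* m :^ 3 :* n :^ 3 :* (l :* (x₂ :- x₁) :- (y₂ :- y₁)))
            refl m x₁ y₁ x₂ y₂ n l))
        (Z.solve 1 (λ ν →
             (Z.con ℤ.1ℤ Z.:+ ν) Z.:* (Z.con (ℤ.+ 216) Z.:- Z.con (ℤ.+ 216) Z.:* ν Z.:^ 3)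
             Z.:= (Z.con (ℤ.+ 36) Z.:- Z.con (ℤ.+ 36) Z.:* ν Z.:^ 2) Z.:*
               (Z.con (ℤ.+ 6) Z.:* (Z.con ℤ.1ℤ Z.:+ ν Z.:+ ν Z.:^ 2))) ≡.refl ν)

      -- The chord formula persists at ν = 1: `m⁴ α` vanishes at m = 0, and 216 · 18 = 3 · 36².
      tangentSlope : ∀ α l → ν ≡ ℤ.1ℤ → Val (m ^ 4 * α) ℤ.0ℤ → l * (# 2 * y₁) ≈ # 3 * x₁ ^ 2 + α →
        Val (n * (# 1 + n) * (m * l)) (slope-val ν)
      tangentSlope α l ≡.refl α-val e = Val-quotient
        Y₁-val (λ ())
        (Val-⟦⟧ (:# 3 :* var 0F :^ 2 :+ var 1F) {A₁ ∷ m ^ 4 * α ∷ []} (X₁-val ∷ α-val ∷ []))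
        (combine₁ (m ^ 4) e
          (solve 5 (λ m x₁ y₁ α l →
             :# 1 :^ 3 :* (m :^ 3 :* y₁) :* (:# 1 :* (:# 1 :+ :# 1) :* (m :* l))
             :- (:# 3 :* (:# 1 :^ 2 :* (m :^ 2 :* x₁)) :^ 2 :+ m :^ 4 :* α)
             := m :^ 4 :* (l :* (:# 2 :* y₁) :- (:# 3 :* x₁ :^ 2 :+ α)))
            refl m x₁ y₁ α l))
        ≡.refl

      -- The addition law of the cuspidal cubic. For the abscissa it reads (1 + ν + ν²)² - ν² (1 +
      -- ν)² - (1 + ν)² = ν², and for the ordinate (1 + ν + ν²) ((1 + ν)² - 1) - ν (1 + ν)³ = ν.
      third-leading : ∀ l → Val (n * (# 1 + n) * (m * l)) (slope-val ν) →
        let x₃ = l ^ 2 - x₁ - x₂ in Leading (ℤ.1ℤ ℤ.+ ν) x₃ (l * (x₁ - x₃) - y₁)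
      third-leading l z-val = leading
        (Val-≈ (*-cong (*-cong (sym hn) (*-cong (sym hn) refl)) refl) X₃-val)
        (Val-≈ (*-cong (*-cong (sym hn) (*-cong (sym hn) (*-cong (sym hn) refl))) refl) Y₃-val)
        where
        x₃ = l ^ 2 - x₁ - x₂
        y₃ = l * (x₁ - x₃) - y₁
        z = n * (# 1 + n) * (m * l)

        hn : fromℤ (ℤ.1ℤ ℤ.+ ν) ≈ # 1 + n
        hn = fromℤ.+-homo ℤ.1ℤ ν

        ν²≢0 : ν ℤ.^ 2 ≢ ℤ.0ℤ
        ν²≢0 e with ℤₚ.i*j≡0⇒i≡0∨j≡0 ν e
        ... | inj₁ ν≡0 = ν≢0 ν≡0
        ... | inj₂ ν≡0 = ν≢0 (≡.trans (≡.sym (ℤₚ.*-identityʳ ν)) ν≡0)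

        X₃-val : Val ((# 1 + n) ^ 2 * (m ^ 2 * x₃)) (ℤ.+ 36)
        X₃-val = Val-quotient (Val-^ n-val 2) ν²≢0
          (Val-⟦⟧ (let z = var 0F ; A₁ = var 1F ; A₂ = var 2F ; n = var 3F in
              z :^ 2 :- n :^ 2 :* (:# 1 :+ n) :^ 2 :* A₁ :- (:# 1 :+ n) :^ 2 :* A₂)
            {z ∷ A₁ ∷ A₂ ∷ n ∷ []} (z-val ∷ X₁-val ∷ X₂-val ∷ n-val ∷ []))
          (solve 5 (λ m x₁ x₂ n l →
              n :^ 2 :* ((:# 1 :+ n) :^ 2 :* (m :^ 2 :* (l :^ 2 :- x₁ :- x₂)))
              := (n :* (:# 1 :+ n) :* (m :* l)) :^ 2
                 :- n :^ 2 :* (:# 1 :+ n) :^ 2 :* (:# 1 :^ 2 :* (m :^ 2 :* x₁))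
                 :- (:# 1 :+ n) :^ 2 :* (n :^ 2 :* (m :^ 2 :* x₂)))
            refl m x₁ x₂ n l)
          (Z.solve 1 (λ ν → let 1+ν = Z.con ℤ.1ℤ Z.:+ ν ; 36′ = Z.con (ℤ.+ 36) in
              (Z.con (ℤ.+ 6) Z.:* (1+ν Z.:+ ν Z.:^ 2)) Z.:^ 2 Z.:- ν Z.:^ 2 Z.:* 1+ν Z.:^ 2 Z.:* 36′ Z.:- 1+ν Z.:^ 2 Z.:* 36′
              Z.:= ν Z.:^ 2 Z.:* 36′) ≡.refl ν)

        Y₃-val : Val ((# 1 + n) ^ 3 * (m ^ 3 * y₃)) (ℤ.+ 216)
        Y₃-val = Val-quotient n-val ν≢0
          (Val-⟦⟧ (let z = var 0F ; A₁ = var 1F ; A₃ = var 2F ; B₁ = var 3F ; n = var 4F in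
              z :* ((:# 1 :+ n) :^ 2 :* A₁ :- A₃) :- n :* (:# 1 :+ n) :^ 3 :* B₁)
            {z ∷ A₁ ∷ (# 1 + n) ^ 2 * (m ^ 2 * x₃) ∷ B₁ ∷ n ∷ []} (z-val ∷ X₁-val ∷ X₃-val ∷ Y₁-val ∷ n-val ∷ []))
          (solve 6 (λ m x₁ y₁ x₃ n l →
              n :* ((:# 1 :+ n) :^ 3 :* (m :^ 3 :* (l :* (x₁ :- x₃) :- y₁)))
              := n :* (:# 1 :+ n) :* (m :* l) :* ((:# 1 :+ n) :^ 2 :* (:# 1 :^ 2 :* (m :^ 2 :* x₁)) :- (:# 1 :+ n) :^ 2 :* (m :^ 2 :* x₃))
                 :- n :* (:# 1 :+ n) :^ 3 :* (:# 1 :^ 3 :* (m :^ 3 :* y₁)))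
            refl m x₁ y₁ x₃ n l)
          (Z.solve 1 (λ ν → let 1+ν = Z.con ℤ.1ℤ Z.:+ ν ; 36′ = Z.con (ℤ.+ 36) ; 216′ = Z.con (ℤ.+ 216) in
              (Z.con (ℤ.+ 6) Z.:* (1+ν Z.:+ ν Z.:^ 2)) Z.:* (1+ν Z.:^ 2 Z.:* 36′ Z.:- 36′) Z.:- ν Z.:* 1+ν Z.:^ 3 Z.:* 216′
              Z.:= ν Z.:* 216′) ≡.refl ν)

    module _ {ν : ℤ} {X Y : K} (lead : Leading ν X Y) where
      open Leading lead
      private n = fromℤ ν

      -- `excluded` is a polynomial in `m`, hence negligible against the double pole of `X`; 216 = 6
      -- · 36.
      excluded-val : Val (n ^ 2 * (m ^ 2 * (# 6 * (X - excluded)))) (ℤ.+ 216)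
      excluded-val = ≡.subst (Val _)
        (Z.solve 1 (λ ν → Z.con (ℤ.+ 6) Z.:* (Z.con (ℤ.+ 36) Z.:- ν Z.:^ 2 Z.:* Z.con ℤ.0ℤ) Z.:= Z.con (ℤ.+ 216)) ≡.refl ν)
        (Val-≈ (solve 3 (λ m X n → let open Poly m in
            :# 6 :* (n :^ 2 :* (m :^ 2 :* X) :- n :^ 2 :* (m :^ 2 :* :excl))
            := n :^ 2 :* (m :^ 2 :* (:# 6 :* (X :- :excl)))) refl m X n)
          (Val-⟦⟧ (let open Poly (var 0F) ; m = var 0F ; A = var 1F ; n = var 2F in
              :# 6 :* (A :- n :^ 2 :* (m :^ 2 :* :excl)))
            (Val-m ∷ X-val ∷ Val-fromℤ ν ∷ [])))

      X≉excluded : X ≉ excluded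
      X≉excluded X≈ = Val⇒≉0 excluded-val (λ ()) (begin
        n ^ 2 * (m ^ 2 * (# 6 * (X - excluded)))   ≈⟨ *-congˡ (*-congˡ (*-difference≈0 (# 6) X≈)) ⟩
        n ^ 2 * (m ^ 2 * 0#)                       ≈⟨ *-congˡ (zeroʳ (m ^ 2)) ⟩
        n ^ 2 * 0#                                 ≈⟨ zeroʳ (n ^ 2) ⟩
        0#                                         ∎)

      -- In the numerator of `toU` the terms `m Y` and `6 D X` contribute 216 ν⁻³ m⁻² and 216 ν⁻²
      -- m⁻², against 216 ν⁻² m⁻² in the denominator; the last term is regular.
      toU-val : Val (n * toU X Y) (ℤ.1ℤ ℤ.+ ν)
      toU-val = Val-quotient excluded-val (λ ())
        (Val-⟦⟧ (let m = var 0F ; A = var 1F ; B = var 2F ; n = var 3F in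
            B :+ :# 6 :* :D m :* A :* n :+ n :^ 3 :* (m :^ 2 :* (:# 72 :* :D m :^ 2 :* (m :^ 2 :- :# 1))))
          {m ∷ n ^ 2 * (m ^ 2 * X) ∷ n ^ 3 * (m ^ 3 * Y) ∷ n ∷ []} (Val-m ∷ X-val ∷ Y-val ∷ Val-fromℤ ν ∷ []))
        (combine₁ (n ^ 3 * m ^ 2) (*-/-cancel (toU-num X Y) (*-≉0 (#≉0 5) (λ e → X≉excluded (x-y≈0⇒x≈y X excluded e))))
          (solve 5 (λ m X Y n U → let open Poly m in
              n :^ 2 :* (m :^ 2 :* (:# 6 :* (X :- :excl))) :* (n :* U)
              :- (n :^ 3 :* (m :^ 3 :* Y) :+ :# 6 :* :D m :* (n :^ 2 :* (m :^ 2 :* X)) :* n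
                  :+ n :^ 3 :* (m :^ 2 :* (:# 72 :* :D m :^ 2 :* (m :^ 2 :- :# 1))))
              := n :^ 3 :* m :^ 2 :* (:# 6 :* (X :- :excl) :* U :- :num X Y))
            refl m X Y n (toU X Y)))
        (Z.solve 1 (λ ν → let 216′ = Z.con (ℤ.+ 216) in
            216′ Z.:+ 216′ Z.:* ν Z.:+ ν Z.:^ 3 Z.:* Z.con ℤ.0ℤ Z.:= 216′ Z.:* (Z.con ℤ.1ℤ Z.:+ ν)) ≡.refl ν)

    -- Compares the leading term 6 (ν m)⁻¹ of Y / X, cross-multiplied; X alone would determine ν
    -- only up to sign. The constant is 7776 = 216 · 36.
    Leading-injective : ∀ {ν μ X Y X′ Y′} → Leading ν X Y → Leading μ X′ Y′ → X ≈ X′ → Y ≈ Y′ → ν ≡ μ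
    Leading-injective {ν} {μ} {X} {Y} {X′} {Y′} (leading vX vY) (leading vX′ vY′) X≈X′ Y≈Y′ =
      ≡.sym (ℤₚ.*-cancelˡ-≡ (ℤ.+ 7776) μ ν (Val-unique
        (Val-* (Val-* vY vX′) (Val-fromℤ μ))
        (Val-≈ (combine₂ (k * X) (k * Y) (sym Y≈Y′) X≈X′
            (solve 7 (λ m X Y X′ Y′ n l →
                l :^ 3 :* (m :^ 3 :* Y′) :* (n :^ 2 :* (m :^ 2 :* X)) :* n
                :- n :^ 3 :* (m :^ 3 :* Y) :* (l :^ 2 :* (m :^ 2 :* X′)) :* l
                := n :^ 3 :* l :^ 3 :* m :^ 5 :* X :* (Y′ :- Y)
                   :+ n :^ 3 :* l :^ 3 :* m :^ 5 :* Y :* (X :- X′)) refl m X Y X′ Y′ n l))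
          (Val-* (Val-* vY′ vX) (Val-fromℤ ν)))))
      where
      n = fromℤ ν
      l = fromℤ μ
      k = n ^ 3 * l ^ 3 * m ^ 5

    private
      cross-injective : ∀ ν μ → (ℤ.1ℤ ℤ.+ ν) ℤ.* μ ≡ (ℤ.1ℤ ℤ.+ μ) ℤ.* ν → ν ≡ μ
      cross-injective ν μ e = ≡.sym (≡.trans
        (Z.solve 2 (λ ν μ → μ Z.:= (Z.con ℤ.1ℤ Z.:+ ν) Z.:* μ Z.:- ν Z.:* μ) ≡.refl ν μ) (≡.trans
        (≡.cong (ℤ._- ν ℤ.* μ) e)
        (Z.solve 2 (λ ν μ → (Z.con ℤ.1ℤ Z.:+ μ) Z.:* ν Z.:- ν Z.:* μ Z.:= ν) ≡.refl ν μ)))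

      -- Its value at m = 0 is (μ (1 + μ))² when n, l, u, w have the values ν, μ, 1 + ν, 1 + μ.
      :invariant : ∀ {k} (m n l u w : Polynomial k) → Polynomial k
      :invariant m n l u w = ((n :* :D m :- u) :* (u :- n) :* w :* l) :^ 2

    module _ {ν μ : ℤ} {U U′ : K} (vU : Val (fromℤ ν * U) (ℤ.1ℤ ℤ.+ ν)) (vU′ : Val (fromℤ μ * U′) (ℤ.1ℤ ℤ.+ μ)) where
      private
        n = fromℤ ν
        l = fromℤ μ

      U-injective : U ≈ U′ → ν ≡ μ
      U-injective U≈U′ = cross-injective ν μ (Val-unique
        (Val-* vU (Val-fromℤ μ))
        (Val-≈ (combine₁ (n * l) (sym U≈U′)
            (solve 4 (λ n l U U′ → l :* U′ :* n :- n :* U :* l := n :* l :* (U′ :- U)) refl n l U U′))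
          (Val-* vU′ (Val-fromℤ ν))))

      -- The hypothesis is the equality of the two quotients e₁ e₂ / e₃, each equal to ((D - U) (U -
      -- 1) / (m² U))², after clearing denominators.
      invariant-val : ((D - U) * (U - # 1) * U′) ^ 2 ≈ ((D - U′) * (U′ - # 1) * U) ^ 2 →
        (μ ℤ.* (ℤ.1ℤ ℤ.+ μ)) ℤ.^ 2 ≡ (ν ℤ.* (ℤ.1ℤ ℤ.+ ν)) ℤ.^ 2
      invariant-val e = ≡.trans (value ν μ) (≡.trans
        (Val-unique (Val-⟦⟧ p vs) (Val-≈ ⟦q⟧≈⟦p⟧ (Val-⟦⟧ q vs)))
        (≡.sym (value μ ν)))
        where
        p q : Polynomial 5
        p = :invariant (var 0F) (var 1F) (var 2F) (var 3F) (var 4F)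
        q = :invariant (var 0F) (var 2F) (var 1F) (var 4F) (var 3F)

        ρ : Vec K 5
        ρ = m ∷ n ∷ l ∷ n * U ∷ l * U′ ∷ []

        vs : Pointwise Val ρ (ℤ.0ℤ ∷ ν ∷ μ ∷ ℤ.1ℤ ℤ.+ ν ∷ ℤ.1ℤ ℤ.+ μ ∷ [])
        vs = Val-m ∷ Val-fromℤ ν ∷ Val-fromℤ μ ∷ vU ∷ vU′ ∷ []

        ⟦q⟧≈⟦p⟧ : ⟦ q ⟧ ρ ≈ ⟦ p ⟧ ρ
        ⟦q⟧≈⟦p⟧ = combine₁ (- ((n * l) ^ 4)) e
          (solve 5 (λ m n l U U′ →
              :invariant m l n (l :* U′) (n :* U) :- :invariant m n l (n :* U) (l :* U′)
              := (:- ((n :* l) :^ 4)) :* (((:D m :- U) :* (U :- :# 1) :* U′) :^ 2 :- ((:D m :- U′) :* (U′ :- :# 1) :* U) :^ 2))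
            refl m n l U U′)

        value : ∀ ν μ → (μ ℤ.* (ℤ.1ℤ ℤ.+ μ)) ℤ.^ 2
          ≡ ⟦ :invariant (var 0F) (var 1F) (var 2F) (var 3F) (var 4F) ⟧ℤ
              (ℤ.0ℤ ∷ ν ∷ μ ∷ ℤ.1ℤ ℤ.+ ν ∷ ℤ.1ℤ ℤ.+ μ ∷ [])
        value = Z.solve 2 (λ ν μ → let 1′ = Z.con ℤ.1ℤ in
          (μ Z.:* (1′ Z.:+ μ)) Z.:^ 2
          Z.:= ((ν Z.:* 1′ Z.:- (1′ Z.:+ ν)) Z.:* (1′ Z.:+ ν Z.:- ν) Z.:* (1′ Z.:+ μ) Z.:* μ) Z.:^ 2) ≡.refl

  -- An invariant of triples up to order and scaling

  open import Algebra.Properties.Semiring.Sum semiring using (sum; sum-permute; sum-cong-≋; *-distribˡ-sum)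
  open import Algebra.Properties.CommutativeMonoid.Sum (CommutativeRing.*-commutativeMonoid R)
    using () renaming (sum to product; sum-permute to product-permute; sum-cong-≋ to product-cong)

  module _ (F G : Vector K 3) (σ : Permutation′ 3) (c : K) (F≈cG : ∀ i → F i ≈ c * G (σ ⟨$⟩ʳ i)) where
    private
      -- Power sums stand in for e₁ and e₂, since as sums over all indices they are visibly
      -- unchanged by a permutation.
      p₁ p₂ : Vector K 3 → K
      p₁ = sum
      p₂ f = sum (λ i → f i * f i)

      p₁-scale : p₁ F ≈ c * p₁ G
      p₁-scale = begin
        sum F                              ≈⟨ sum-cong-≋ F≈cG ⟩
        sum (λ i → c * G (σ ⟨$⟩ʳ i))       ≈⟨ *-distribˡ-sum c (λ i → G (σ ⟨$⟩ʳ i)) ⟨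
        c * sum (λ i → G (σ ⟨$⟩ʳ i))       ≈⟨ *-congˡ (sum-permute G σ) ⟨
        c * sum G                          ∎

      p₂-scale : p₂ F ≈ c * c * p₂ G
      p₂-scale = begin
        sum (λ i → F i * F i)
          ≈⟨ sum-cong-≋ (λ i → trans (*-cong (F≈cG i) (F≈cG i))
               (solve 2 (λ c g → c :* g :* (c :* g) := c :* c :* (g :* g)) refl c (G (σ ⟨$⟩ʳ i)))) ⟩
        sum (λ i → c * c * (G (σ ⟨$⟩ʳ i) * G (σ ⟨$⟩ʳ i)))
          ≈⟨ *-distribˡ-sum (c * c) (λ i → G (σ ⟨$⟩ʳ i) * G (σ ⟨$⟩ʳ i)) ⟨
        c * c * sum (λ i → G (σ ⟨$⟩ʳ i) * G (σ ⟨$⟩ʳ i))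
          ≈⟨ *-congˡ (sum-permute (λ i → G i * G i) σ) ⟨
        c * c * p₂ G ∎

      product-scale : product F ≈ c * c * c * product G
      product-scale = begin
        product F                          ≈⟨ product-cong F≈cG ⟩
        product (λ i → c * G (σ ⟨$⟩ʳ i))
          ≈⟨ solve 5 (λ c g h k u → c :* g :* (c :* h :* (c :* k :* u)) := c :* c :* c :* (g :* (h :* (k :* u)))) refl
               c (G (σ ⟨$⟩ʳ 0F)) (G (σ ⟨$⟩ʳ 1F)) (G (σ ⟨$⟩ʳ 2F)) 1# ⟩
        c * c * c * product (λ i → G (σ ⟨$⟩ʳ i))       ≈⟨ *-congˡ (product-permute G σ) ⟨
        c * c * c * product G              ∎

    -- 2 e₁ e₂ = p₁ (p₁² - p₂), and e₁ e₂ / e₃ is homogeneous of degree 0.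
    proportional : p₁ F * (p₁ F * p₁ F - p₂ F) * product G ≈ p₁ G * (p₁ G * p₁ G - p₂ G) * product F
    proportional = combine₃
      (product G * (p₁ F * p₁ F + p₁ F * (c * p₁ G) + c * c * p₁ G * p₁ G - c * c * p₂ G))
      (- (p₁ F * product G)) (- (p₁ G * (p₁ G * p₁ G - p₂ G)))
      p₁-scale p₂-scale product-scale
      (solve 7 (λ c s t w s′ t′ w′ →
          s :* (s :* s :- t) :* w′ :- s′ :* (s′ :* s′ :- t′) :* w
          := w′ :* (s :* s :+ s :* (c :* s′) :+ c :* c :* s′ :* s′ :- c :* c :* t′) :* (s :- c :* s′)
             :+ (:- (s :* w′)) :* (t :- c :* c :* t′)
             :+ (:- (s′ :* (s′ :* s′ :- t′))) :* (w :- c :* c :* c :* w′))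
        refl c (p₁ F) (p₂ F) (product F) (p₁ G) (p₂ G) (product G))

  module SimilarTriples {U V e U′ V′ e′ : K} (quartic : OnQuartic U V) (quartic′ : OnQuartic U′ V′)
    (e≉0 : e ≉ 0#) (e′≉0 : e′ ≉ 0#) (D≉0 : D ≉ 0#) where
    private
      module T = Triple U V e quartic
      module T′ = Triple U′ V′ e′ quartic′

      sum₃ : ∀ (f : Vector K 3) → sum f ≈ f 0F + f 1F + f 2F
      sum₃ f = trans (+-cong refl (+-cong refl (+-identityʳ (f 2F)))) (sym (+-assoc (f 0F) (f 1F) (f 2F)))

      product₃ : ∀ (f : Vector K 3) → product f ≈ f 0F * f 1F * f 2F
      product₃ f = trans (*-congˡ (*-congˡ (*-identityʳ (f 2F)))) (sym (*-assoc (f 0F) (f 1F) (f 2F)))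

      E : ∀ {U V e} (quartic : OnQuartic U V) → let open Triple U V e quartic in
        sum f * (sum f * sum f - sum (λ i → f i * f i)) ≈ # 2 * (p * q) ^ 2
      E {U} {V} {e} quartic = trans
        (*-cong (sum₃ f) (+-cong (*-cong (sum₃ f) (sum₃ f)) (-‿cong (sum₃ (λ i → f i * f i)))))
        (combine₂ (# 2 * (f 0F * f 1F + f 1F * f 2F + f 2F * f 0F)) (# 2 * (p * p)) e₁-square e₂-square
          (solve 5 (λ a b c p q → let s = a :+ b :+ c ; t = a :* b :+ b :* c :+ c :* a in
              s :* (s :* s :- (a :* a :+ b :* b :+ c :* c)) :- :# 2 :* (p :* q) :^ 2
              := :# 2 :* t :* (s :- p :* p) :+ :# 2 :* (p :* p) :* (t :- q :* q))
            refl (f 0F) (f 1F) (f 2F) p q))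
        where open Triple U V e quartic

      -- The part of 2 (p q r′)² that is symmetric in the two triples; 64 = 2 · 4 · 8 from the
      -- coefficients of p, q and r′.
      common : K → K → K
      common e e′ = # 2 * (# 64 * m ^ 4 * D ^ 2 * (e ^ 3 * e′ ^ 3)) ^ 2

      factor : ∀ U e U′ e′ →
        # 2 * ((# 2 * (e * D - e * U)) * (# 4 * m * e * D * (e * U - e))) ^ 2
          * ((# 8 * m ^ 3 * e′ ^ 2 * (e′ * U′) * D) * (# 8 * m ^ 3 * e′ ^ 2 * (e′ * U′) * D))
        ≈ # 2 * (# 64 * m ^ 4 * D ^ 2 * (e ^ 3 * e′ ^ 3)) ^ 2 * ((D - U) * (U - # 1) * U′) ^ 2
      factor = solve 5 (λ m U e U′ e′ →
        let r′ = :# 8 :* m :^ 3 :* e′ :^ 2 :* (e′ :* U′) :* :D m in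
        :# 2 :* ((:# 2 :* (e :* :D m :- e :* U)) :* (:# 4 :* m :* e :* :D m :* (e :* U :- e))) :^ 2 :* (r′ :* r′)
        := :# 2 :* (:# 64 :* m :^ 4 :* :D m :^ 2 :* (e :^ 3 :* e′ :^ 3)) :^ 2 :* ((:D m :- U) :* (U :- :# 1) :* U′) :^ 2)
        refl m

    similar⇒ : ∀ (σ : Permutation′ 3) c → (∀ i → T.f i ≈ c * T′.f (σ ⟨$⟩ʳ i)) →
      ((D - U) * (U - # 1) * U′) ^ 2 ≈ ((D - U′) * (U′ - # 1) * U) ^ 2
    similar⇒ σ c F≈cG = *-cancelˡ common≉0 (begin
      common e e′ * ((D - U) * (U - # 1) * U′) ^ 2           ≈⟨ factor U e U′ e′ ⟨
      # 2 * (T.p * T.q) ^ 2 * (T′.r * T′.r)                  ≈⟨ *-cong (E {U} {V} {e} quartic) (trans (product₃ T′.f) T′.e₃-square) ⟨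
      _                                                      ≈⟨ proportional T.f T′.f σ c F≈cG ⟩
      _                                                      ≈⟨ *-cong (E {U′} {V′} {e′} quartic′) (trans (product₃ T.f) T.e₃-square) ⟩
      # 2 * (T′.p * T′.q) ^ 2 * (T.r * T.r)                  ≈⟨ factor U′ e′ U e ⟩
      common e′ e * ((D - U′) * (U′ - # 1) * U) ^ 2
        ≈⟨ solve 5 (λ m a b d i →
             :# 2 :* (:# 64 :* m :^ 4 :* d :^ 2 :* (b :* a)) :^ 2 :* i := :# 2 :* (:# 64 :* m :^ 4 :* d :^ 2 :* (a :* b)) :^ 2 :* i) refl
             m (e ^ 3) (e′ ^ 3) D (((D - U′) * (U′ - # 1) * U) ^ 2) ⟩
      common e e′ * ((D - U′) * (U′ - # 1) * U) ^ 2          ∎)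
      where
      common≉0 : common e e′ ≉ 0#
      common≉0 = *-≉0 (#≉0 1) (^-≉0 2 (*-≉0 (*-≉0 (*-≉0 (#≉0 63) (^-≉0 4 m≉0)) (^-≉0 2 D≉0))
        (*-≉0 (^-≉0 3 e≉0) (^-≉0 3 e′≉0))))

  -- The point P and the addition of P to its multiples

  module BasePoint (place : Place ℤ.0ℤ) where
    open Place place
    open AtZero place

    xP yP : K
    xP = - (# 12 * (m ^ 6 - # 4 * m ^ 2 - # 3)) / m ^ 2
    yP = # 216 * D ^ 2 / m ^ 3

    private
      hx : m ^ 2 * xP ≈ - (# 12 * (m ^ 6 - # 4 * m ^ 2 - # 3))
      hx = *-/-cancel _ (^-≉0 2 m≉0)

      hy : m ^ 3 * yP ≈ # 216 * D ^ 2
      hy = *-/-cancel _ (^-≉0 3 m≉0)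

    P-onCurve : yP ^ 2 ≈ xP ^ 3 + α * xP + β
    P-onCurve = *-cancelˡ (^-≉0 6 m≉0) (combine₂
      -- The divided difference of the cubic A³ + m⁴ α A + m⁶ β between A = `m² xP` and the
      -- polynomial equal to it.
      (- ((m ^ 2 * xP) ^ 2 + m ^ 2 * xP * (- (# 12 * (m ^ 6 - # 4 * m ^ 2 - # 3))) + (- (# 12 * (m ^ 6 - # 4 * m ^ 2 - # 3))) ^ 2 + m ^ 4 * α))
      (m ^ 3 * yP + # 216 * D ^ 2) hx hy
      (solve 3 (λ m x y → let open Poly m
                              N = :- (:# 12 :* (m :^ 6 :- :# 4 :* m :^ 2 :- :# 3)) in
          m :^ 6 :* y :^ 2 :- m :^ 6 :* (x :^ 3 :+ :α :* x :+ :β)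
          := (:- ((m :^ 2 :* x) :^ 2 :+ m :^ 2 :* x :* N :+ N :^ 2 :+ m :^ 4 :* :α)) :* (m :^ 2 :* x :- N)
             :+ (m :^ 3 :* y :+ :# 216 :* :D m :^ 2) :* (m :^ 3 :* y :- :# 216 :* :D m :^ 2))
        refl m xP yP))

    P-leading : Leading ℤ.1ℤ xP yP
    P-leading = leading
      (Val-* (Val-^ (Val-fromℤ ℤ.1ℤ) 2) (Val-≈ (sym hx)
        (Val-⟦⟧ (let m = var 0F in :- (:# 12 :* (m :^ 6 :- :# 4 :* m :^ 2 :- :# 3))) (Val-m ∷ []))))
      (Val-* (Val-^ (Val-fromℤ ℤ.1ℤ) 3) (Val-≈ (sym hy)
        (Val-⟦⟧ (let m = var 0F in :# 216 :* :D m :^ 2) (Val-m ∷ []))))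

    -- The curve has good reduction at m = 0: there `α` is 864, positive, and `β` is nonzero.
    nonsingular : # 4 * α ^ 3 + # 27 * β ^ 2 ≉ 0#
    nonsingular = Val⇒≉0 (Val-⟦⟧ (let open Poly (var 0F) in :# 4 :* :α :^ 3 :+ :# 27 :* :β :^ 2) (Val-m ∷ [])) (λ ())

    D≉0 : D ≉ 0#
    D≉0 = Val⇒≉0 (Val-⟦⟧ (:D (var 0F)) (Val-m ∷ [])) (λ ())

    OnCurve : K → K → Set
    OnCurve x y = y ^ 2 ≈ x ^ 3 + α * x + β

    module Doubling (l : K) where
      2yP≉0 : # 2 * yP ≉ 0#
      2yP≉0 e = Val⇒≉0 (Val-* (Val-fromℤ (ℤ.+ 2)) (Leading.Y-val P-leading)) (λ ()) (begin
        # 2 * (# 1 ^ 3 * (m ^ 3 * yP))    ≈⟨ solve 2 (λ m y → :# 2 :* (:# 1 :^ 3 :* (m :^ 3 :* y)) := m :^ 3 :* (:# 2 :* y)) refl m yP ⟩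
        m ^ 3 * (# 2 * yP)                ≈⟨ *-congˡ e ⟩
        m ^ 3 * 0#                        ≈⟨ zeroʳ (m ^ 3) ⟩
        0#                                ∎)

      yP≉-yP : yP ≉ - yP
      yP≉-yP e = 2yP≉0 (begin
        # 2 * yP       ≈⟨ solve 1 (λ y → :# 2 :* y := y :- (:- y)) refl yP ⟩
        yP - (- yP)    ≈⟨ x≈y⇒x-y≈0 e ⟩
        0#             ∎)

      double : l ≈ (# 3 * xP ^ 2 + α) / (# 2 * yP) →
        let x₃ = l ^ 2 - xP - xP ; y₃ = l * (xP - x₃) - yP in
        OnCurve x₃ y₃ × Leading (ℤ.+ 2) x₃ y₃
      double l≈ =
        Addition.tangentPoint-onCurve α β l xP yP P-onCurve slope ,
        Sum.third-leading ℤ.1ℤ (λ ()) P-leading P-leading l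
          (Sum.tangentSlope ℤ.1ℤ (λ ()) P-leading P-leading α l ≡.refl
            (Val-⟦⟧ (let open Poly (var 0F) ; m = var 0F in m :^ 4 :* :α) (Val-m ∷ [])) slope)
        where
        slope : l * (# 2 * yP) ≈ # 3 * xP ^ 2 + α
        slope = trans (*-cong l≈ refl) (trans (*-comm _ _) (*-/-cancel _ 2yP≉0))

    module Chord (ν : ℤ) (ν≢0 : ν ≢ ℤ.0ℤ) (nondegenerate : ℤ.+ 36 ℤ.- ℤ.+ 36 ℤ.* ν ℤ.^ 2 ≢ ℤ.0ℤ)
      {x₂ y₂ : K} (onCurve : OnCurve x₂ y₂) (lead : Leading ν x₂ y₂) where

      -- `n² m² (x₂ - xP)` has the value `36 - 36 ν²` at m = 0.
      x₂-xP≉0 : x₂ - xP ≉ 0#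
      x₂-xP≉0 e = Val⇒≉0
        (Val-⟦⟧ (let A₁ = var 0F ; A₂ = var 1F ; n = var 2F in A₂ :- A₁ :* n :^ 2)
          (Leading.X-val P-leading ∷ Leading.X-val lead ∷ Val-fromℤ ν ∷ []))
        nondegenerate (begin
          _ ≈⟨ solve 4 (λ m x₁ x₂ n → n :^ 2 :* (m :^ 2 :* x₂) :- :# 1 :^ 2 :* (m :^ 2 :* x₁) :* n :^ 2
                 := n :^ 2 :* m :^ 2 :* (x₂ :- x₁)) refl m xP x₂ (fromℤ ν) ⟩
          fromℤ ν ^ 2 * m ^ 2 * (x₂ - xP)   ≈⟨ *-congˡ e ⟩
          fromℤ ν ^ 2 * m ^ 2 * 0#          ≈⟨ zeroʳ _ ⟩
          0# ∎)

      xP≉x₂ : xP ≉ x₂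
      xP≉x₂ e = x₂-xP≉0 (x≈y⇒x-y≈0 (sym e))

      chord : ∀ l → l ≈ (y₂ - yP) / (x₂ - xP) →
        let x₃ = l ^ 2 - xP - x₂ ; y₃ = l * (xP - x₃) - yP in
        OnCurve x₃ y₃ × Leading (ℤ.1ℤ ℤ.+ ν) x₃ y₃
      chord l l≈ =
        Addition.chordPoint-onCurve α β l xP yP x₂ y₂ P-onCurve onCurve x₂-xP≉0 slope ,
        Sum.third-leading ν ν≢0 P-leading lead l (Sum.chordSlope ν ν≢0 P-leading lead l nondegenerate slope)
        where
        slope : l * (x₂ - xP) ≈ y₂ - yP
        slope = trans (*-cong l≈ refl) (trans (*-comm _ _) (*-/-cancel _ x₂-xP≉0))

open import Defs
open import Relation.Binary.PropositionalEquality
  using (refl; sym; trans; cong; cong₂; subst; module ≡-Reasoning)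
open Q using (solve; _:=_; _:+_; _:*_; _:-_; :-_; con)

-- Values of polynomials

⌜_⌝ : ℤ → ℚ
⌜ i ⌝ = i ℚ./ 1

-- For a variable `i` the normalisation inside `i ℚ./ 1` does not compute, so the homomorphism laws
-- are proved in the unnormalised rationals and transported back.
toℚᵘ-⌜⌝ : ∀ i → ℚ.toℚᵘ ⌜ i ⌝ ℚᵘ.≃ mkℚᵘ i 0
toℚᵘ-⌜⌝ i = ℚₚ.toℚᵘ-fromℚᵘ (mkℚᵘ i 0)

⌜⌝-homo-+ : ∀ i j → ⌜ i ℤ.+ j ⌝ ≡ ⌜ i ⌝ ℚ.+ ⌜ j ⌝
⌜⌝-homo-+ i j = ℚₚ.toℚᵘ-injective (begin
  ℚ.toℚᵘ ⌜ i ℤ.+ j ⌝                 ≈⟨ toℚᵘ-⌜⌝ (i ℤ.+ j) ⟩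
  mkℚᵘ (i ℤ.+ j) 0                   ≈⟨ ℚᵘ.*≡* (cong (ℤ._* ℤ.1ℤ) (sym (cong₂ ℤ._+_ (ℤₚ.*-identityʳ i) (ℤₚ.*-identityʳ j)))) ⟩
  mkℚᵘ i 0 ℚᵘ.+ mkℚᵘ j 0             ≈⟨ ℚᵘₚ.+-cong (toℚᵘ-⌜⌝ i) (toℚᵘ-⌜⌝ j) ⟨
  ℚ.toℚᵘ ⌜ i ⌝ ℚᵘ.+ ℚ.toℚᵘ ⌜ j ⌝     ≈⟨ ℚₚ.toℚᵘ-homo-+ ⌜ i ⌝ ⌜ j ⌝ ⟨
  ℚ.toℚᵘ (⌜ i ⌝ ℚ.+ ⌜ j ⌝)           ∎)
  where open ℚᵘₚ.≃-Reasoning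

⌜⌝-homo-* : ∀ i j → ⌜ i ℤ.* j ⌝ ≡ ⌜ i ⌝ ℚ.* ⌜ j ⌝
⌜⌝-homo-* i j = ℚₚ.toℚᵘ-injective (begin
  ℚ.toℚᵘ ⌜ i ℤ.* j ⌝                 ≈⟨ toℚᵘ-⌜⌝ (i ℤ.* j) ⟩
  mkℚᵘ i 0 ℚᵘ.* mkℚᵘ j 0             ≈⟨ ℚᵘₚ.*-cong (toℚᵘ-⌜⌝ i) (toℚᵘ-⌜⌝ j) ⟨
  ℚ.toℚᵘ ⌜ i ⌝ ℚᵘ.* ℚ.toℚᵘ ⌜ j ⌝     ≈⟨ ℚₚ.toℚᵘ-homo-* ⌜ i ⌝ ⌜ j ⌝ ⟨
  ℚ.toℚᵘ (⌜ i ⌝ ℚ.* ⌜ j ⌝)           ∎)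
  where open ℚᵘₚ.≃-Reasoning

⌜⌝-homo‿- : ∀ i → ⌜ ℤ.- i ⌝ ≡ ℚ.- ⌜ i ⌝
⌜⌝-homo‿- i = ℚₚ.toℚᵘ-injective (begin
  ℚ.toℚᵘ ⌜ ℤ.- i ⌝                   ≈⟨ toℚᵘ-⌜⌝ (ℤ.- i) ⟩
  ℚᵘ.- mkℚᵘ i 0                      ≈⟨ ℚᵘₚ.-‿cong (toℚᵘ-⌜⌝ i) ⟨
  ℚᵘ.- ℚ.toℚᵘ ⌜ i ⌝                  ≈⟨ ℚₚ.toℚᵘ-homo‿- ⌜ i ⌝ ⟨
  ℚ.toℚᵘ (ℚ.- ⌜ i ⌝)                 ∎)
  where open ℚᵘₚ.≃-Reasoning

⌜⌝-injective : ∀ {i j} → ⌜ i ⌝ ≡ ⌜ j ⌝ → i ≡ j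
⌜⌝-injective {i} {j} i≡j = begin
  i            ≡⟨ ℤₚ.*-identityʳ i ⟨
  i ℤ.* ℤ.1ℤ   ≡⟨ ℚᵘₚ.drop-*≡* (ℚᵘₚ.≃-trans (ℚᵘₚ.≃-sym (toℚᵘ-⌜⌝ i)) (ℚᵘₚ.≃-trans (ℚᵘₚ.≃-reflexive (cong ℚ.toℚᵘ i≡j)) (toℚᵘ-⌜⌝ j))) ⟩
  j ℤ.* ℤ.1ℤ   ≡⟨ ℤₚ.*-identityʳ j ⟩
  j            ∎
  where open ≡-Reasoning

infix 9 _at_

_at_ : ℚ[m] → ℚ → ℚ
[]      at x = 0ℚ
(a ∷ p) at x = a ℚ.+ x ℚ.* p at x

at-constant : ∀ c k → (c ∷ []) at k ≡ c
at-constant c k = trans (cong (c ℚ.+_) (ℚₚ.*-zeroʳ k)) (ℚₚ.+-identityʳ c)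

at-+ : ∀ p q x → (p +ₚ q) at x ≡ p at x ℚ.+ q at x
at-+ []      q       x = sym (ℚₚ.+-identityˡ _)
at-+ (a ∷ p) []      x = sym (ℚₚ.+-identityʳ _)
at-+ (a ∷ p) (b ∷ q) x rewrite at-+ p q x =
  solve 5 (λ a b x p q → a :+ b :+ x :* (p :+ q) := a :+ x :* p :+ (b :+ x :* q))
    refl a b x (p at x) (q at x)

at-neg : ∀ p x → (-ₚ p) at x ≡ ℚ.- p at x
at-neg []      x = refl
at-neg (a ∷ p) x rewrite at-neg p x =
  solve 3 (λ a x p → :- a :+ x :* :- p := :- (a :+ x :* p)) refl a x (p at x)

at-scale : ∀ c p x → (map (c ℚ.*_) p) at x ≡ c ℚ.* p at x
at-scale c []      x = sym (ℚₚ.*-zeroʳ c)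
at-scale c (a ∷ p) x rewrite at-scale c p x =
  solve 4 (λ c a x p → c :* a :+ x :* (c :* p) := c :* (a :+ x :* p)) refl c a x (p at x)

at-* : ∀ p q x → (p *ₚ q) at x ≡ p at x ℚ.* q at x
at-* []      q x = sym (ℚₚ.*-zeroˡ (q at x))
at-* (a ∷ p) q x
  rewrite at-+ (map (a ℚ.*_) q) (0ℚ ∷ p *ₚ q) x | at-scale a q x | at-* p q x =
  solve 4 (λ a x p q → a :* q :+ (con 0ℚ :+ x :* (p :* q)) := (a :+ x :* p) :* q)
    refl a x (p at x) (q at x)

IsZero⇒at≡0 : ∀ {p} → IsZero p → ∀ x → p at x ≡ 0ℚ
IsZero⇒at≡0 []         x = refl
IsZero⇒at≡0 (refl ∷ z) x rewrite IsZero⇒at≡0 z x = trans (ℚₚ.+-identityˡ _) (ℚₚ.*-zeroʳ x)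

private
  -- Synthetic division: the quotient of (a ∷ p) by m - r.
  quotient : ℚ → ℚ[m] → ℚ[m]
  quotient r []      = []
  quotient r (b ∷ p) = (b ∷ p) at r ∷ quotient r p

  length-quotient : ∀ r p → length (quotient r p) ≡ length p
  length-quotient r []      = refl
  length-quotient r (b ∷ p) = cong suc (length-quotient r p)

  -- This is division of `a ∷ p` by m - r with remainder: the constant term `a` drops out of the
  -- difference of the values at `x` and `r`.
  division : ∀ r p x → x ℚ.* p at x ≡ r ℚ.* p at r ℚ.+ (x ℚ.- r) ℚ.* quotient r p at x
  division r []      x = solve 2 (λ x r → x :* con 0ℚ := r :* con 0ℚ :+ (x :- r) :* con 0ℚ) refl x r
  division r (b ∷ p) x rewrite division r p x =
    solve 5 (λ b x r p q →
        x :* (b :+ (r :* p :+ (x :- r) :* q))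
        := r :* (b :+ r :* p) :+ (x :- r) :* (b :+ r :* p :+ x :* q))
      refl b x r (p at r) (quotient r p at x)

  -- The coefficients of the quotient are the Horner values at `r` of the tails of `p`, so the
  -- coefficients of `p` are recovered from the top degree downwards.
  quotient-zero : ∀ r p → IsZero (quotient r p) → p at r ≡ 0ℚ × IsZero p
  quotient-zero r []      []      = refl , []
  quotient-zero r (b ∷ p) (e ∷ z) with quotient-zero r p z
  ... | p≡0 , zp = e , trans (sym b+0) e ∷ zp
    where
    b+0 : b ℚ.+ r ℚ.* p at r ≡ b
    b+0 rewrite p≡0 = trans (cong (b ℚ.+_) (ℚₚ.*-zeroʳ r)) (ℚₚ.+-identityʳ b)

  x-y≡0⇒x≡y : ∀ x y → x ℚ.- y ≡ 0ℚ → x ≡ y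
  x-y≡0⇒x≡y x y e = trans (solve 2 (λ x y → x := x :- y :+ y) refl x y)
    (trans (cong (ℚ._+ y) e) (ℚₚ.+-identityˡ y))

  a*b≡0⇒b≡0 : ∀ {a b} → a ≢ 0ℚ → a ℚ.* b ≡ 0ℚ → b ≡ 0ℚ
  a*b≡0⇒b≡0 {a} {b} a≢0 ab≡0 = begin
    b                        ≡⟨ ℚₚ.*-identityˡ b ⟨
    1ℚ ℚ.* b                 ≡⟨ cong (ℚ._* b) (ℚₚ.*-inverseˡ a) ⟨
    ℚ.1/ a ℚ.* a ℚ.* b       ≡⟨ ℚₚ.*-assoc (ℚ.1/ a) a b ⟩
    ℚ.1/ a ℚ.* (a ℚ.* b)     ≡⟨ cong (ℚ.1/ a ℚ.*_) ab≡0 ⟩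
    ℚ.1/ a ℚ.* 0ℚ            ≡⟨ ℚₚ.*-zeroʳ (ℚ.1/ a) ⟩
    0ℚ                       ∎
    where
    open ≡-Reasoning
    instance _ = ℚ.≢-nonZero a≢0

  -- Dividing by m - n leaves a polynomial, shorter by one, that vanishes at all integers beyond
  -- `n`. The length `l` is an argument because the quotient is not a subterm.
  manyRoots : ∀ l n p → length p ≡ l →
              (∀ k → n ℕ.≤ k → p at ⌜ ℤ.+ k ⌝ ≡ 0ℚ) → IsZero p
  manyRoots l       n []      _    _    = []
  manyRoots (suc l) n (a ∷ p) len root =
    (begin
      a                     ≡⟨ ℚₚ.+-identityʳ a ⟨
      a ℚ.+ 0ℚ              ≡⟨ cong (a ℚ.+_) (trans (cong (r ℚ.*_) p≡0) (ℚₚ.*-zeroʳ r)) ⟨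
      a ℚ.+ r ℚ.* p at r    ≡⟨ root n ℕₚ.≤-refl ⟩
      0ℚ                    ∎)
    ∷ zp
    where
    open ≡-Reasoning
    r = ⌜ ℤ.+ n ⌝
    q = quotient r p

    root′ : ∀ k → suc n ℕ.≤ k → q at ⌜ ℤ.+ k ⌝ ≡ 0ℚ
    root′ k n<k = a*b≡0⇒b≡0 x-r≢0 (begin
      (x ℚ.- r) ℚ.* q at x
        ≡⟨ solve 3 (λ a s t → t := a :+ (s :+ t) :- (a :+ s)) refl
             a (r ℚ.* p at r) ((x ℚ.- r) ℚ.* q at x) ⟩
      a ℚ.+ (r ℚ.* p at r ℚ.+ (x ℚ.- r) ℚ.* q at x) ℚ.- (a ∷ p) at r
        ≡⟨ cong (λ s → a ℚ.+ s ℚ.- (a ∷ p) at r) (division r p x) ⟨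
      (a ∷ p) at x ℚ.- (a ∷ p) at r
        ≡⟨ cong₂ ℚ._-_ (root k (ℕₚ.<⇒≤ n<k)) (root n ℕₚ.≤-refl) ⟩
      0ℚ ∎)
      where
      x = ⌜ ℤ.+ k ⌝
      x-r≢0 : x ℚ.- r ≢ 0ℚ
      x-r≢0 e = ℕₚ.<⇒≢ n<k (sym (ℤₚ.+-injective (⌜⌝-injective (x-y≡0⇒x≡y x r e))))

    both = quotient-zero r p (manyRoots l (suc n) q (trans (length-quotient r p) (ℕₚ.suc-injective len)) root′)
    p≡0 = proj₁ both
    zp  = proj₂ both

-- Turns equality in `K` into equality of rational numbers at every point, where the solver over ℚ
-- applies.
at≡0⇒IsZero : ∀ p → (∀ x → p at x ≡ 0ℚ) → IsZero p
at≡0⇒IsZero p root = manyRoots (length p) 0 p refl (λ k _ → root ⌜ ℤ.+ k ⌝)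

-- The field K

private
  cross : ∀ x y k → (num x *ₚ den y +ₚ -ₚ (num y *ₚ den x)) at k
                  ≡ num x at k ℚ.* den y at k ℚ.- num y at k ℚ.* den x at k
  cross x y k rewrite at-+ (num x *ₚ den y) (-ₚ (num y *ₚ den x)) k
                    | at-neg (num y *ₚ den x) k
                    | at-* (num x) (den y) k | at-* (num y) (den x) k = refl

≈-intro : ∀ x y → (∀ k → num x at k ℚ.* den y at k ≡ num y at k ℚ.* den x at k) → x ≈ y
≈-intro x y eq = at≡0⇒IsZero _ λ k → begin
  (num x *ₚ den y +ₚ -ₚ (num y *ₚ den x)) at k               ≡⟨ cross x y k ⟩
  num x at k ℚ.* den y at k ℚ.- num y at k ℚ.* den x at k    ≡⟨ cong (ℚ._- (num y at k ℚ.* den x at k)) (eq k) ⟩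
  num y at k ℚ.* den x at k ℚ.- num y at k ℚ.* den x at k    ≡⟨ ℚₚ.+-inverseʳ (num y at k ℚ.* den x at k) ⟩
  0ℚ                                                         ∎
  where open ≡-Reasoning

≈-elim : ∀ x y → x ≈ y → ∀ k → num x at k ℚ.* den y at k ≡ num y at k ℚ.* den x at k
≈-elim x y x≈y k = x-y≡0⇒x≡y _ _ (trans (sym (cross x y k)) (IsZero⇒at≡0 x≈y k))

private
  num-+ : ∀ x y k → num (x + y) at k ≡ num x at k ℚ.* den y at k ℚ.+ num y at k ℚ.* den x at k
  num-+ x y k rewrite at-+ (num x *ₚ den y) (num y *ₚ den x) k
                    | at-* (num x) (den y) k | at-* (num y) (den x) k = refl

  -- Sums and products have the same denominator.
  den-∙ : ∀ x y k → den (x + y) at k ≡ den x at k ℚ.* den y at k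
  den-∙ x y = at-* (den x) (den y)

  num-* : ∀ x y k → num (x * y) at k ≡ num x at k ℚ.* num y at k
  num-* x y = at-* (num x) (num y)

  num-neg : ∀ x k → num (- x) at k ≡ ℚ.- num x at k
  num-neg x = at-neg (num x)

  linearCombination : ∀ c d {a b a′ b′ l r} → a ≡ b → a′ ≡ b′ →
    l ℚ.- r ≡ c ℚ.* (a ℚ.- b) ℚ.+ d ℚ.* (a′ ℚ.- b′) → l ≡ r
  linearCombination c d {a} {a′ = a′} {l = l} {r} refl refl eq = x-y≡0⇒x≡y l r (trans eq
    (solve 4 (λ c d a a′ → c :* (a :- a) :+ d :* (a′ :- a′) := con 0ℚ) refl c d a a′))

≈-refl : ∀ {x} → x ≈ x
≈-refl {x} = ≈-intro x x λ _ → refl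

≈-sym : ∀ {x y} → x ≈ y → y ≈ x
≈-sym {x} {y} x≈y = ≈-intro y x λ k → sym (≈-elim x y x≈y k)

-- The two cross-multiplied equations yield the third only after multiplication by `den y`, which is
-- removed because ℚ[m] has no zero divisors. That fact is a negative statement, hence the appeal to
-- decidability.
≈-trans : ∀ {x y z} → x ≈ y → y ≈ z → x ≈ z
≈-trans {x} {y} {z} x≈y y≈z = decidable-stable (isZero? _) λ x≉z →
  *ₚ-nonZero (den y) _ (den≢0 y) x≉z (at≡0⇒IsZero _ λ k → begin
    (den y *ₚ (num x *ₚ den z +ₚ -ₚ (num z *ₚ den x))) at k
      ≡⟨ trans (at-* (den y) _ k) (cong (den y at k ℚ.*_) (cross x z k)) ⟩
    den y at k ℚ.* (num x at k ℚ.* den z at k ℚ.- num z at k ℚ.* den x at k)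
      ≡⟨ solve 6 (λ nx dx ny dy nz dz →
             dy :* (nx :* dz :- nz :* dx)
             := dz :* (nx :* dy) :- dz :* (ny :* dx) :+ (dx :* (ny :* dz) :- dx :* (nz :* dy)))
           refl (num x at k) (den x at k) (num y at k) (den y at k) (num z at k) (den z at k) ⟩
    _ ≡⟨ cong₂ (λ s t → den z at k ℚ.* s ℚ.- den z at k ℚ.* (num y at k ℚ.* den x at k)
                      ℚ.+ (den x at k ℚ.* t ℚ.- den x at k ℚ.* (num z at k ℚ.* den y at k)))
               (≈-elim x y x≈y k) (≈-elim y z y≈z k) ⟩
    _ ≡⟨ solve 2 (λ s t → s :- s :+ (t :- t) := con 0ℚ) refl
           (den z at k ℚ.* (num y at k ℚ.* den x at k)) (den x at k ℚ.* (num z at k ℚ.* den y at k)) ⟩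
    0ℚ ∎)
  where open ≡-Reasoning

+-cong : ∀ {x x′ y y′} → x ≈ x′ → y ≈ y′ → x + y ≈ x′ + y′
+-cong {x} {x′} {y} {y′} x≈x′ y≈y′ = ≈-intro (x + y) (x′ + y′) eq
  where
  eq : ∀ k → num (x + y) at k ℚ.* den (x′ + y′) at k ≡ num (x′ + y′) at k ℚ.* den (x + y) at k
  eq k rewrite num-+ x y k | num-+ x′ y′ k | at-* (den x) (den y) k | at-* (den x′) (den y′) k =
    linearCombination (den y at k ℚ.* den y′ at k) (den x at k ℚ.* den x′ at k)
      (≈-elim x x′ x≈x′ k) (≈-elim y y′ y≈y′ k)
      (solve 8 (λ n d n′ d′ f e f′ e′ →
          (n :* e :+ f :* d) :* (d′ :* e′) :- (n′ :* e′ :+ f′ :* d′) :* (d :* e)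
          := e :* e′ :* (n :* d′ :- n′ :* d) :+ d :* d′ :* (f :* e′ :- f′ :* e))
        refl (num x at k) (den x at k) (num x′ at k) (den x′ at k)
             (num y at k) (den y at k) (num y′ at k) (den y′ at k))

*-cong : ∀ {x x′ y y′} → x ≈ x′ → y ≈ y′ → x * y ≈ x′ * y′
*-cong {x} {x′} {y} {y′} x≈x′ y≈y′ = ≈-intro (x * y) (x′ * y′) eq
  where
  eq : ∀ k → num (x * y) at k ℚ.* den (x′ * y′) at k ≡ num (x′ * y′) at k ℚ.* den (x * y) at k
  eq k rewrite at-* (num x) (num y) k | at-* (num x′) (num y′) k
             | at-* (den x) (den y) k | at-* (den x′) (den y′) k =
    linearCombination (num y at k ℚ.* den y′ at k) (num x′ at k ℚ.* den x at k)
      (≈-elim x x′ x≈x′ k) (≈-elim y y′ y≈y′ k)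
      (solve 8 (λ n d n′ d′ f e f′ e′ →
          (n :* f) :* (d′ :* e′) :- (n′ :* f′) :* (d :* e)
          := f :* e′ :* (n :* d′ :- n′ :* d) :+ n′ :* d :* (f :* e′ :- f′ :* e))
        refl (num x at k) (den x at k) (num x′ at k) (den x′ at k)
             (num y at k) (den y at k) (num y′ at k) (den y′ at k))

-‿cong : ∀ {x x′} → x ≈ x′ → - x ≈ - x′
-‿cong {x} {x′} x≈x′ = ≈-intro (- x) (- x′) eq
  where
  eq : ∀ k → num (- x) at k ℚ.* den x′ at k ≡ num (- x′) at k ℚ.* den x at k
  eq k rewrite at-neg (num x) k | at-neg (num x′) k = begin
    (ℚ.- num x at k) ℚ.* den x′ at k   ≡⟨ ℚₚ.neg-distribˡ-* (num x at k) (den x′ at k) ⟨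
    ℚ.- (num x at k ℚ.* den x′ at k)   ≡⟨ cong (ℚ.-_) (≈-elim x x′ x≈x′ k) ⟩
    ℚ.- (num x′ at k ℚ.* den x at k)   ≡⟨ ℚₚ.neg-distribˡ-* (num x′ at k) (den x at k) ⟩
    (ℚ.- num x′ at k) ℚ.* den x at k   ∎
    where open ≡-Reasoning

module _ (x y z : K) where
  private
    n f h d e g : ℚ → ℚ
    n k = num x at k
    d k = den x at k
    f k = num y at k
    e k = den y at k
    h k = num z at k
    g k = den z at k

  +-assoc : x + y + z ≈ x + (y + z)
  +-assoc = ≈-intro (x + y + z) (x + (y + z)) eq
    where
    eq : ∀ k → num (x + y + z) at k ℚ.* den (x + (y + z)) at k
             ≡ num (x + (y + z)) at k ℚ.* den (x + y + z) at k
    eq k rewrite num-+ (x + y) z k | num-+ x y k | num-+ x (y + z) k | num-+ y z k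
               | den-∙ (x + y) z k | den-∙ x y k | den-∙ x (y + z) k | den-∙ y z k =
      solve 6 (λ n d f e h g →
          ((n :* e :+ f :* d) :* g :+ h :* (d :* e)) :* (d :* (e :* g))
          := (n :* (e :* g) :+ (f :* g :+ h :* e) :* d) :* (d :* e :* g))
        refl (n k) (d k) (f k) (e k) (h k) (g k)

  *-assoc : x * y * z ≈ x * (y * z)
  *-assoc = ≈-intro (x * y * z) (x * (y * z)) eq
    where
    eq : ∀ k → num (x * y * z) at k ℚ.* den (x * (y * z)) at k
             ≡ num (x * (y * z)) at k ℚ.* den (x * y * z) at k
    eq k rewrite num-* (x * y) z k | num-* x y k | num-* x (y * z) k | num-* y z k
               | den-∙ (x * y) z k | den-∙ x y k | den-∙ x (y * z) k | den-∙ y z k =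
      solve 6 (λ n d f e h g →
          n :* f :* h :* (d :* (e :* g)) := n :* (f :* h) :* (d :* e :* g))
        refl (n k) (d k) (f k) (e k) (h k) (g k)

  *-distribˡ-+ : x * (y + z) ≈ x * y + x * z
  *-distribˡ-+ = ≈-intro (x * (y + z)) (x * y + x * z) eq
    where
    eq : ∀ k → num (x * (y + z)) at k ℚ.* den (x * y + x * z) at k
             ≡ num (x * y + x * z) at k ℚ.* den (x * (y + z)) at k
    eq k rewrite num-* x (y + z) k | num-+ y z k | num-+ (x * y) (x * z) k | num-* x y k | num-* x z k
               | den-∙ x (y + z) k | den-∙ y z k | den-∙ (x * y) (x * z) k | den-∙ x y k | den-∙ x z k =
      solve 6 (λ n d f e h g →
          n :* (f :* g :+ h :* e) :* (d :* e :* (d :* g))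
          := (n :* f :* (d :* g) :+ n :* h :* (d :* e)) :* (d :* (e :* g)))
        refl (n k) (d k) (f k) (e k) (h k) (g k)

+-comm : ∀ x y → x + y ≈ y + x
+-comm x y = ≈-intro (x + y) (y + x) eq
  where
  eq : ∀ k → num (x + y) at k ℚ.* den (y + x) at k ≡ num (y + x) at k ℚ.* den (x + y) at k
  eq k rewrite num-+ x y k | num-+ y x k | den-∙ x y k | den-∙ y x k =
    solve 4 (λ n d f e → (n :* e :+ f :* d) :* (e :* d) := (f :* d :+ n :* e) :* (d :* e))
      refl (num x at k) (den x at k) (num y at k) (den y at k)

*-comm : ∀ x y → x * y ≈ y * x
*-comm x y = ≈-intro (x * y) (y * x) eq
  where
  eq : ∀ k → num (x * y) at k ℚ.* den (y * x) at k ≡ num (y * x) at k ℚ.* den (x * y) at k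
  eq k rewrite num-* x y k | num-* y x k | den-∙ x y k | den-∙ y x k =
    solve 4 (λ n d f e → n :* f :* (e :* d) := f :* n :* (d :* e))
      refl (num x at k) (den x at k) (num y at k) (den y at k)

+-identityˡ : ∀ x → 0# + x ≈ x
+-identityˡ x = ≈-intro (0# + x) x eq
  where
  eq : ∀ k → num (0# + x) at k ℚ.* den x at k ≡ num x at k ℚ.* den (0# + x) at k
  eq k rewrite num-+ 0# x k | den-∙ 0# x k | at-constant 1ℚ k =
    solve 2 (λ n d → (con 0ℚ :* d :+ n :* con 1ℚ) :* d := n :* (con 1ℚ :* d))
      refl (num x at k) (den x at k)

*-identityˡ : ∀ x → 1# * x ≈ x
*-identityˡ x = ≈-intro (1# * x) x eq
  where
  eq : ∀ k → num (1# * x) at k ℚ.* den x at k ≡ num x at k ℚ.* den (1# * x) at k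
  eq k rewrite num-* 1# x k | den-∙ 1# x k | at-constant 1ℚ k =
    solve 2 (λ n d → con 1ℚ :* n :* d := n :* (con 1ℚ :* d))
      refl (num x at k) (den x at k)

-‿inverseˡ : ∀ x → - x + x ≈ 0#
-‿inverseˡ x = ≈-intro (- x + x) 0# eq
  where
  eq : ∀ k → num (- x + x) at k ℚ.* (1ℚ ∷ []) at k ≡ 0ℚ ℚ.* den (- x + x) at k
  eq k rewrite num-+ (- x) x k | num-neg x k | den-∙ (- x) x k | at-constant 1ℚ k =
    solve 2 (λ n d → ((:- n) :* d :+ n :* d) :* con 1ℚ := con 0ℚ :* (d :* d))
      refl (num x at k) (den x at k)

isCommutativeRing : IsCommutativeRing _≈_ _+_ _*_ -_ 0# 1#
isCommutativeRing = FromLaws.isCommutativeRing _≈_ _+_ _*_ -_ 0# 1#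
  (record { refl = λ {x} → ≈-refl {x}
          ; sym = λ {x} {y} → ≈-sym {x} {y}
          ; trans = λ {x} {y} {z} → ≈-trans {x} {y} {z} })
  (λ {x} {x′} {y} {y′} → +-cong {x} {x′} {y} {y′})
  (λ {x} {x′} {y} {y′} → *-cong {x} {x′} {y} {y′})
  (λ {x} {x′} → -‿cong {x} {x′})
  +-assoc *-assoc +-comm *-comm +-identityˡ *-identityˡ -‿inverseˡ *-distribˡ-+

K-commutativeRing : CommutativeRing 0ℓ 0ℓ
K-commutativeRing = record { isCommutativeRing = isCommutativeRing }

module CS = Algebra.Properties.CommutativeSemigroup (CommutativeRing.*-commutativeSemigroup K-commutativeRing)

fromℤ : ℤ → K
fromℤ i = polynomial (⌜ i ⌝ ∷ [])

constant : ℚ → K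
constant c = polynomial (c ∷ [])

≈-by : ∀ x y {n d n′ d′ : ℚ → ℚ} →
  (∀ k → num x at k ≡ n k) → (∀ k → den x at k ≡ d k) →
  (∀ k → num y at k ≡ n′ k) → (∀ k → den y at k ≡ d′ k) →
  (∀ k → n k ℚ.* d′ k ≡ n′ k ℚ.* d k) → x ≈ y
≈-by x y n d n′ d′ eq = ≈-intro x y λ k →
  trans (cong₂ ℚ._*_ (n k) (d′ k)) (trans (eq k) (sym (cong₂ ℚ._*_ (n′ k) (d k))))

constant-+ : ∀ a b → constant (a ℚ.+ b) ≈ constant a + constant b
constant-+ a b = ≈-by (constant (a ℚ.+ b)) (constant a + constant b)
  (at-constant (a ℚ.+ b)) (at-constant 1ℚ)
  (λ k → trans (num-+ (constant a) (constant b) k) (cong₂ ℚ._+_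
     (cong₂ ℚ._*_ (at-constant a k) (at-constant 1ℚ k)) (cong₂ ℚ._*_ (at-constant b k) (at-constant 1ℚ k))))
  (λ k → trans (den-∙ (constant a) (constant b) k) (cong₂ ℚ._*_ (at-constant 1ℚ k) (at-constant 1ℚ k)))
  (λ k → solve 2 (λ a b → (a :+ b) :* (con 1ℚ :* con 1ℚ) := (a :* con 1ℚ :+ b :* con 1ℚ) :* con 1ℚ) refl a b)

constant-* : ∀ a b → constant (a ℚ.* b) ≈ constant a * constant b
constant-* a b = ≈-by (constant (a ℚ.* b)) (constant a * constant b)
  (at-constant (a ℚ.* b)) (at-constant 1ℚ)
  (λ k → trans (num-* (constant a) (constant b) k) (cong₂ ℚ._*_ (at-constant a k) (at-constant b k)))
  (λ k → trans (den-∙ (constant a) (constant b) k) (cong₂ ℚ._*_ (at-constant 1ℚ k) (at-constant 1ℚ k)))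
  (λ k → solve 2 (λ a b → a :* b :* (con 1ℚ :* con 1ℚ) := a :* b :* con 1ℚ) refl a b)

constant-neg : ∀ a → constant (ℚ.- a) ≈ - constant a
constant-neg a = ≈-by (constant (ℚ.- a)) (- constant a)
  (at-constant (ℚ.- a)) (at-constant 1ℚ)
  (λ k → trans (num-neg (constant a) k) (cong ℚ.-_ (at-constant a k))) (at-constant 1ℚ)
  (λ k → refl)

fromℤ-morphism : ℤ.+-*-rawRing -Raw-AlmostCommutative⟶ fromCommutativeRing K-commutativeRing
fromℤ-morphism = record
  { ⟦_⟧    = fromℤ
  ; +-homo = λ i j → subst (λ c → constant c ≈ fromℤ i + fromℤ j) (sym (⌜⌝-homo-+ i j)) (constant-+ ⌜ i ⌝ ⌜ j ⌝)
  ; *-homo = λ i j → subst (λ c → constant c ≈ fromℤ i * fromℤ j) (sym (⌜⌝-homo-* i j)) (constant-* ⌜ i ⌝ ⌜ j ⌝)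
  ; -‿homo = λ i → subst (λ c → constant c ≈ - fromℤ i) (sym (⌜⌝-homo‿- i)) (constant-neg ⌜ i ⌝)
  ; 0-homo = ≈-by (fromℤ ℤ.0ℤ) 0# (at-constant 0ℚ) (at-constant 1ℚ) (λ _ → refl) (at-constant 1ℚ) (λ _ → refl)
  ; 1-homo = ≈-refl {1#}
  }

num-zero⇒≈0 : ∀ x → IsZero (num x) → x ≈ 0#
num-zero⇒≈0 x z = ≈-by x 0# (IsZero⇒at≡0 z) (λ _ → refl) (λ _ → refl) (at-constant 1ℚ)
  λ k → trans (ℚₚ.*-zeroˡ 1ℚ) (sym (ℚₚ.*-zeroˡ (den x at k)))

*-inverseʳ : ∀ x → ¬ x ≈ 0# → x * x ⁻¹ ≈ 1#
*-inverseʳ x x≉0 with isZero? (num x)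
... | yes z = contradiction (num-zero⇒≈0 x z) x≉0
... | no nz = ≈-by (x * x′) 1# (num-* x x′) (den-∙ x x′) (at-constant 1ℚ) (at-constant 1ℚ)
  λ k → solve 2 (λ n d → n :* d :* con 1ℚ := con 1ℚ :* (d :* n)) refl (num x at k) (den x at k)
  where x′ = den x ÷ num x [ nz ]

*-≢0 : ∀ {a b} → a ≢ 0ℚ → b ≢ 0ℚ → a ℚ.* b ≢ 0ℚ
*-≢0 a≢0 b≢0 ab≡0 = b≢0 (a*b≡0⇒b≡0 a≢0 ab≡0)

*-cancelʳ-ℚ : ∀ {a b c} → c ≢ 0ℚ → a ℚ.* c ≡ b ℚ.* c → a ≡ b
*-cancelʳ-ℚ {a} {b} {c} c≢0 e = x-y≡0⇒x≡y a b (a*b≡0⇒b≡0 c≢0 (trans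
  (solve 3 (λ a b c → c :* (a :- b) := a :* c :- b :* c) refl a b c)
  (trans (cong (ℚ._- b ℚ.* c) e) (ℚₚ.+-inverseʳ (b ℚ.* c)))))

1≢0ℚ : 1ℚ ≢ 0ℚ
1≢0ℚ ()

-- Places and integral polynomials

-- Fractions are not reduced: the denominator of `x` itself may vanish at `k` although the function
-- is regular there. Hence the freely chosen representative `y`.
record Val (k : ℤ) (x : K) (c : ℤ) : Set where
  constructor val
  field
    y       : K
    x≈y     : x ≈ y
    regular : den y at ⌜ k ⌝ ≢ 0ℚ
    value   : num y at ⌜ k ⌝ ≡ ⌜ c ⌝ ℚ.* den y at ⌜ k ⌝

module _ {k : ℤ} where
  private
    κ = ⌜ k ⌝

  Val-≈ : ∀ {x y c} → x ≈ y → Val k x c → Val k y c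
  Val-≈ {x} {x′} x≈x′ (val y x≈y r v) = val y (≈-trans {x′} {x} {y} (≈-sym {x} {x′} x≈x′) x≈y) r v

  Val-polynomial : ∀ p c → p at κ ≡ ⌜ c ⌝ → Val k (polynomial p) c
  Val-polynomial p c e = val (polynomial p) (≈-refl {polynomial p})
    (λ z → 1≢0ℚ (trans (sym (at-constant 1ℚ κ)) z))
    (trans e (sym (trans (cong (⌜ c ⌝ ℚ.*_) (at-constant 1ℚ κ)) (ℚₚ.*-identityʳ ⌜ c ⌝))))

  Val-fromℤ : ∀ i → Val k (fromℤ i) i
  Val-fromℤ i = Val-polynomial (⌜ i ⌝ ∷ []) i (at-constant ⌜ i ⌝ κ)

  Val-m : Val k m k
  Val-m = Val-polynomial (0ℚ ∷ 1ℚ ∷ []) k (trans (ℚₚ.+-identityˡ _)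
    (trans (cong (κ ℚ.*_) (at-constant 1ℚ κ)) (ℚₚ.*-identityʳ κ)))

  Val-+ : ∀ {x y c d} → Val k x c → Val k y d → Val k (x + y) (c ℤ.+ d)
  Val-+ {x} {y} {c} {d} (val x′ x≈x′ rx vx) (val y′ y≈y′ ry vy) =
    val (x′ + y′) (+-cong {x} {x′} {y} {y′} x≈x′ y≈y′)
      (λ e → *-≢0 rx ry (trans (sym (den-∙ x′ y′ κ)) e))
      (begin
        num (x′ + y′) at κ
          ≡⟨ num-+ x′ y′ κ ⟩
        num x′ at κ ℚ.* den y′ at κ ℚ.+ num y′ at κ ℚ.* den x′ at κ
          ≡⟨ cong₂ (λ s t → s ℚ.* den y′ at κ ℚ.+ t ℚ.* den x′ at κ) vx vy ⟩
        ⌜ c ⌝ ℚ.* den x′ at κ ℚ.* den y′ at κ ℚ.+ ⌜ d ⌝ ℚ.* den y′ at κ ℚ.* den x′ at κ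
          ≡⟨ solve 4 (λ c d e f → c :* e :* f :+ d :* f :* e := (c :+ d) :* (e :* f)) refl
               ⌜ c ⌝ ⌜ d ⌝ (den x′ at κ) (den y′ at κ) ⟩
        (⌜ c ⌝ ℚ.+ ⌜ d ⌝) ℚ.* (den x′ at κ ℚ.* den y′ at κ)
          ≡⟨ cong₂ ℚ._*_ (⌜⌝-homo-+ c d) (den-∙ x′ y′ κ) ⟨
        ⌜ c ℤ.+ d ⌝ ℚ.* den (x′ + y′) at κ ∎)
    where open ≡-Reasoning

  Val-* : ∀ {x y c d} → Val k x c → Val k y d → Val k (x * y) (c ℤ.* d)
  Val-* {x} {y} {c} {d} (val x′ x≈x′ rx vx) (val y′ y≈y′ ry vy) =
    val (x′ * y′) (*-cong {x} {x′} {y} {y′} x≈x′ y≈y′)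
      (λ e → *-≢0 rx ry (trans (sym (den-∙ x′ y′ κ)) e))
      (begin
        num (x′ * y′) at κ
          ≡⟨ num-* x′ y′ κ ⟩
        num x′ at κ ℚ.* num y′ at κ
          ≡⟨ cong₂ ℚ._*_ vx vy ⟩
        (⌜ c ⌝ ℚ.* den x′ at κ) ℚ.* (⌜ d ⌝ ℚ.* den y′ at κ)
          ≡⟨ solve 4 (λ c d e f → (c :* e) :* (d :* f) := (c :* d) :* (e :* f)) refl
               ⌜ c ⌝ ⌜ d ⌝ (den x′ at κ) (den y′ at κ) ⟩
        (⌜ c ⌝ ℚ.* ⌜ d ⌝) ℚ.* (den x′ at κ ℚ.* den y′ at κ)
          ≡⟨ cong₂ ℚ._*_ (⌜⌝-homo-* c d) (den-∙ x′ y′ κ) ⟨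
        ⌜ c ℤ.* d ⌝ ℚ.* den (x′ * y′) at κ ∎)
    where open ≡-Reasoning

  Val-neg : ∀ {x c} → Val k x c → Val k (- x) (ℤ.- c)
  Val-neg {x} {c} (val x′ x≈x′ rx vx) = val (- x′) (-‿cong {x} {x′} x≈x′) rx (begin
    num (- x′) at κ                          ≡⟨ num-neg x′ κ ⟩
    ℚ.- num x′ at κ                          ≡⟨ cong ℚ.-_ vx ⟩
    ℚ.- (⌜ c ⌝ ℚ.* den x′ at κ)              ≡⟨ ℚₚ.neg-distribˡ-* ⌜ c ⌝ (den x′ at κ) ⟩
    (ℚ.- ⌜ c ⌝) ℚ.* den x′ at κ              ≡⟨ cong (ℚ._* den x′ at κ) (⌜⌝-homo‿- c) ⟨
    ⌜ ℤ.- c ⌝ ℚ.* den x′ at κ                ∎)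
    where open ≡-Reasoning

  Val-unique : ∀ {x c d} → Val k x c → Val k x d → c ≡ d
  Val-unique {x} {c} {d} (val y x≈y ry vy) (val z x≈z rz vz) =
    ⌜⌝-injective (*-cancelʳ-ℚ (*-≢0 ry rz) (begin
      ⌜ c ⌝ ℚ.* (den y at κ ℚ.* den z at κ)    ≡⟨ ℚₚ.*-assoc ⌜ c ⌝ (den y at κ) (den z at κ) ⟨
      ⌜ c ⌝ ℚ.* den y at κ ℚ.* den z at κ      ≡⟨ cong (ℚ._* den z at κ) vy ⟨
      num y at κ ℚ.* den z at κ                ≡⟨ ≈-elim y z (≈-trans {y} {x} {z} (≈-sym {x} {y} x≈y) x≈z) κ ⟩
      num z at κ ℚ.* den y at κ                ≡⟨ cong (ℚ._* den y at κ) vz ⟩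
      ⌜ d ⌝ ℚ.* den z at κ ℚ.* den y at κ      ≡⟨ solve 3 (λ d e f → d :* f :* e := d :* (e :* f)) refl ⌜ d ⌝ (den y at κ) (den z at κ) ⟩
      ⌜ d ⌝ ℚ.* (den y at κ ℚ.* den z at κ)    ∎))
    where open ≡-Reasoning

  -- The quotient is represented by `z` times the reciprocal of `x′`, which is regular at `k`
  -- because the numerator of `x′` takes there the nonzero value `c` times its denominator.
  Val-cancel : ∀ {x y c d} → Val k x c → c ≢ ℤ.0ℤ → Val k (x * y) (c ℤ.* d) → Val k y d
  Val-cancel {x} {y} {c} {d} (val x′ x≈x′ rx vx) c≢0 (val z xy≈z rz vz) =
    val (z * x″) (quotient-unique K-commutativeRing x y x′ z x″ xy≈z x≈x′ inverse)
      (λ e → *-≢0 rz nx≢0 (trans (sym (den-∙ z x″ κ)) e))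
      (begin
        num (z * x″) at κ
          ≡⟨ num-* z x″ κ ⟩
        num z at κ ℚ.* den x′ at κ
          ≡⟨ cong (ℚ._* den x′ at κ) (trans vz (cong (ℚ._* den z at κ) (⌜⌝-homo-* c d))) ⟩
        ⌜ c ⌝ ℚ.* ⌜ d ⌝ ℚ.* den z at κ ℚ.* den x′ at κ
          ≡⟨ solve 4 (λ c d f e → c :* d :* f :* e := d :* (f :* (c :* e))) refl
               ⌜ c ⌝ ⌜ d ⌝ (den z at κ) (den x′ at κ) ⟩
        ⌜ d ⌝ ℚ.* (den z at κ ℚ.* (⌜ c ⌝ ℚ.* den x′ at κ))
          ≡⟨ cong (λ n → ⌜ d ⌝ ℚ.* (den z at κ ℚ.* n)) vx ⟨
        ⌜ d ⌝ ℚ.* (den z at κ ℚ.* num x′ at κ)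
          ≡⟨ cong (⌜ d ⌝ ℚ.*_) (den-∙ z x″ κ) ⟨
        ⌜ d ⌝ ℚ.* den (z * x″) at κ ∎)
    where
    open ≡-Reasoning
    nx≢0 : num x′ at κ ≢ 0ℚ
    nx≢0 e = *-≢0 (λ z → c≢0 (⌜⌝-injective z)) rx (trans (sym vx) e)
    x″ = den x′ ÷ num x′ [ (λ z → nx≢0 (IsZero⇒at≡0 z κ)) ]
    inverse : x′ * x″ ≈ 1#
    inverse = ≈-by (x′ * x″) 1# (num-* x′ x″) (den-∙ x′ x″) (at-constant 1ℚ) (at-constant 1ℚ)
      λ k → solve 2 (λ n d → n :* d :* con 1ℚ := con 1ℚ :* (d :* n)) refl (num x′ at k) (den x′ at k)

Integer : ℚ → Set
Integer a = ∃[ i ] a ≡ ⌜ i ⌝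

Integral : ℚ[m] → Set
Integral = All Integer

Integer-+ : ∀ {a b} → Integer a → Integer b → Integer (a ℚ.+ b)
Integer-+ (i , refl) (j , refl) = i ℤ.+ j , sym (⌜⌝-homo-+ i j)

Integer-* : ∀ {a b} → Integer a → Integer b → Integer (a ℚ.* b)
Integer-* (i , refl) (j , refl) = i ℤ.* j , sym (⌜⌝-homo-* i j)

Integral-+ : ∀ {p q} → Integral p → Integral q → Integral (p +ₚ q)
Integral-+ []       q        = q
Integral-+ (a ∷ p) []       = a ∷ p
Integral-+ (a ∷ p) (b ∷ q) = Integer-+ a b ∷ Integral-+ p q

Integral-scale : ∀ {c p} → Integer c → Integral p → Integral (map (c ℚ.*_) p)
Integral-scale c []      = []
Integral-scale c (a ∷ p) = Integer-* c a ∷ Integral-scale c p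

Integral-* : ∀ {p q} → Integral p → Integral q → Integral (p *ₚ q)
Integral-* []      q = []
Integral-* (a ∷ p) q = Integral-+ (Integral-scale a q) ((ℤ.0ℤ , refl) ∷ Integral-* p q)

Integral-neg : ∀ {p} → Integral p → Integral (-ₚ p)
Integral-neg []               = []
Integral-neg ((i , refl) ∷ p) = (ℤ.- i , sym (⌜⌝-homo‿- i)) ∷ Integral-neg p

coefficients : ∀ {p} → Integral p → ∃[ z ] p ≡ map ⌜_⌝ z
coefficients []               = [] , refl
coefficients ((i , refl) ∷ p) = i ∷ proj₁ (coefficients p) , cong (⌜ i ⌝ ∷_) (proj₂ (coefficients p))

-- Membership in ℤ[m] up to `≈`. It is closed under the ring operations, which is how the entries of
-- a triple are recognised as integer polynomials.
record Int (x : K) : Set where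
  constructor int
  field
    poly     : ℚ[m]
    integral : Integral poly
    x≈poly   : x ≈ polynomial poly

Int-≈ : ∀ x y → x ≈ y → Int x → Int y
Int-≈ x y x≈y (int p ip e) = int p ip (≈-trans {y} {x} {polynomial p} (≈-sym {x} {y} x≈y) e)

Int⇒ι : ∀ {x} → Int x → ∃[ z ] ι z ≈ x
Int⇒ι {x} (int p ip e) = proj₁ (coefficients ip) ,
  subst (λ q → polynomial q ≈ x) (proj₂ (coefficients ip)) (≈-sym {x} {polynomial p} e)

polynomial-+ : ∀ p q → polynomial p + polynomial q ≈ polynomial (p +ₚ q)
polynomial-+ p q = ≈-by (polynomial p + polynomial q) (polynomial (p +ₚ q))
  (λ k → trans (num-+ (polynomial p) (polynomial q) k)
    (cong₂ ℚ._+_ (cong (p at k ℚ.*_) (at-constant 1ℚ k)) (cong (q at k ℚ.*_) (at-constant 1ℚ k))))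
  (λ k → trans (den-∙ (polynomial p) (polynomial q) k) (cong₂ ℚ._*_ (at-constant 1ℚ k) (at-constant 1ℚ k)))
  (at-+ p q) (at-constant 1ℚ)
  (λ k → solve 2 (λ p q → (p :* con 1ℚ :+ q :* con 1ℚ) :* con 1ℚ := (p :+ q) :* (con 1ℚ :* con 1ℚ)) refl (p at k) (q at k))

polynomial-* : ∀ p q → polynomial p * polynomial q ≈ polynomial (p *ₚ q)
polynomial-* p q = ≈-by (polynomial p * polynomial q) (polynomial (p *ₚ q))
  (num-* (polynomial p) (polynomial q))
  (λ k → trans (den-∙ (polynomial p) (polynomial q) k) (cong₂ ℚ._*_ (at-constant 1ℚ k) (at-constant 1ℚ k)))
  (at-* p q) (at-constant 1ℚ)
  (λ k → solve 2 (λ p q → p :* q :* con 1ℚ := p :* q :* (con 1ℚ :* con 1ℚ)) refl (p at k) (q at k))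

Int-polynomial : ∀ p → Integral p → Int (polynomial p)
Int-polynomial p ip = int p ip (≈-refl {polynomial p})

Int-fromℤ : ∀ i → Int (fromℤ i)
Int-fromℤ i = Int-polynomial (⌜ i ⌝ ∷ []) ((i , refl) ∷ [])

Int-m : Int m
Int-m = Int-polynomial (0ℚ ∷ 1ℚ ∷ []) ((ℤ.0ℤ , refl) ∷ (ℤ.1ℤ , refl) ∷ [])

Int-+ : ∀ {x y} → Int x → Int y → Int (x + y)
Int-+ {x} {y} (int p ip x≈p) (int q iq y≈q) = int (p +ₚ q) (Integral-+ ip iq)
  (≈-trans {x + y} {polynomial p + polynomial q} {polynomial (p +ₚ q)}
    (+-cong {x} {polynomial p} {y} {polynomial q} x≈p y≈q) (polynomial-+ p q))

Int-* : ∀ {x y} → Int x → Int y → Int (x * y)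
Int-* {x} {y} (int p ip x≈p) (int q iq y≈q) = int (p *ₚ q) (Integral-* ip iq)
  (≈-trans {x * y} {polynomial p * polynomial q} {polynomial (p *ₚ q)}
    (*-cong {x} {polynomial p} {y} {polynomial q} x≈p y≈q) (polynomial-* p q))

Int-neg : ∀ {x} → Int x → Int (- x)
Int-neg {x} (int p ip x≈p) = int (-ₚ p) (Integral-neg ip) (-‿cong {x} {polynomial p} x≈p)

⌜↧⌝*≡⌜↥⌝ : ∀ a → ⌜ ℚ.↧ a ⌝ ℚ.* a ≡ ⌜ ℚ.↥ a ⌝
⌜↧⌝*≡⌜↥⌝ a@(mkℚ n d-1 _) = ℚₚ.toℚᵘ-injective (begin
  ℚ.toℚᵘ (⌜ ℚ.↧ a ⌝ ℚ.* a)              ≈⟨ ℚₚ.toℚᵘ-homo-* ⌜ ℚ.↧ a ⌝ a ⟩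
  ℚ.toℚᵘ ⌜ ℚ.↧ a ⌝ ℚᵘ.* ℚ.toℚᵘ a        ≈⟨ ℚᵘₚ.*-congʳ {x = ℚ.toℚᵘ a} (toℚᵘ-⌜⌝ (ℚ.↧ a)) ⟩
  mkℚᵘ (ℚ.↧ a) 0 ℚᵘ.* ℚ.toℚᵘ a          ≈⟨ ℚᵘ.*≡* cross′ ⟩
  mkℚᵘ (ℚ.↥ a) 0                        ≈⟨ toℚᵘ-⌜⌝ (ℚ.↥ a) ⟨
  ℚ.toℚᵘ ⌜ ℚ.↥ a ⌝                      ∎)
  where
  open ℚᵘₚ.≃-Reasoning
  cross′ : ℚ.↧ a ℤ.* ℚ.↥ a ℤ.* ℤ.1ℤ ≡ ℚ.↥ a ℤ.* (ℤ.+ suc (d-1 ℕ.+ 0))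
  cross′ = trans (ℤₚ.*-identityʳ _) (trans (ℤₚ.*-comm (ℚ.↧ a) (ℚ.↥ a))
    (cong (λ d → ℚ.↥ a ℤ.* ℤ.+ suc d) (sym (ℕₚ.+-identityʳ d-1))))

-- The product of the denominators of all coefficients serves as N.
clear : ∀ p → ∃[ N ] N ≢ ℤ.0ℤ × Integral (map (⌜ N ⌝ ℚ.*_) p)
clear []      = ℤ.1ℤ , (λ ()) , []
clear (a ∷ p) with clear p
... | N , N≢0 , ip = N ℤ.* ℚ.↧ a , NM≢0 ,
    (N ℤ.* ℚ.↥ a , head≡) ∷ subst Integral (rescale p) (Integral-scale (ℚ.↧ a , refl) ip)
  where
  open ≡-Reasoning
  NM≢0 : N ℤ.* ℚ.↧ a ≢ ℤ.0ℤ
  NM≢0 e = N≢0 (ℤₚ.*-cancelʳ-≡ N ℤ.0ℤ (ℚ.↧ a) e)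

  head≡ : ⌜ N ℤ.* ℚ.↧ a ⌝ ℚ.* a ≡ ⌜ N ℤ.* ℚ.↥ a ⌝
  head≡ = begin
    ⌜ N ℤ.* ℚ.↧ a ⌝ ℚ.* a             ≡⟨ cong (ℚ._* a) (⌜⌝-homo-* N (ℚ.↧ a)) ⟩
    ⌜ N ⌝ ℚ.* ⌜ ℚ.↧ a ⌝ ℚ.* a         ≡⟨ ℚₚ.*-assoc ⌜ N ⌝ ⌜ ℚ.↧ a ⌝ a ⟩
    ⌜ N ⌝ ℚ.* (⌜ ℚ.↧ a ⌝ ℚ.* a)       ≡⟨ cong (⌜ N ⌝ ℚ.*_) (⌜↧⌝*≡⌜↥⌝ a) ⟩
    ⌜ N ⌝ ℚ.* ⌜ ℚ.↥ a ⌝               ≡⟨ ⌜⌝-homo-* N (ℚ.↥ a) ⟨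
    ⌜ N ℤ.* ℚ.↥ a ⌝                   ∎

  rescale : ∀ q → map (⌜ ℚ.↧ a ⌝ ℚ.*_) (map (⌜ N ⌝ ℚ.*_) q) ≡ map (⌜ N ℤ.* ℚ.↧ a ⌝ ℚ.*_) q
  rescale []      = refl
  rescale (b ∷ q) = cong₂ _∷_ (begin
    ⌜ ℚ.↧ a ⌝ ℚ.* (⌜ N ⌝ ℚ.* b)   ≡⟨ solve 3 (λ d n b → d :* (n :* b) := n :* d :* b) refl ⌜ ℚ.↧ a ⌝ ⌜ N ⌝ b ⟩
    ⌜ N ⌝ ℚ.* ⌜ ℚ.↧ a ⌝ ℚ.* b     ≡⟨ cong (ℚ._* b) (⌜⌝-homo-* N (ℚ.↧ a)) ⟨
    ⌜ N ℤ.* ℚ.↧ a ⌝ ℚ.* b         ∎) (rescale q)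

-- With N clearing the numerator of `x` and M clearing its denominator, N M times the denominator is
-- a suitable `e`, and `e x` is N M times the numerator.
commonDenominator : ∀ x → ∃[ e ] e ≉ 0# × Int e × Int (e * x)
commonDenominator x = e , e≉0 ,
  Int-* (Int-fromℤ N) (Int-polynomial _ (proj₂ (proj₂ (clear (den x))))) ,
  Int-≈ y (e * x) y≈ex (Int-* (Int-fromℤ M) (Int-polynomial _ (proj₂ (proj₂ (clear (num x))))))
  where
  N = proj₁ (clear (num x))
  M = proj₁ (clear (den x))
  e = fromℤ N * polynomial (map (⌜ M ⌝ ℚ.*_) (den x))
  y = fromℤ M * polynomial (map (⌜ N ⌝ ℚ.*_) (num x))

  ⌜⌝≢0 : ∀ {i} → i ≢ ℤ.0ℤ → ⌜ i ⌝ ≢ 0ℚ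
  ⌜⌝≢0 i≢0 e = i≢0 (⌜⌝-injective e)

  num-scaled : ∀ i j p k → num (fromℤ i * polynomial (map (⌜ j ⌝ ℚ.*_) p)) at k ≡ ⌜ i ⌝ ℚ.* (⌜ j ⌝ ℚ.* p at k)
  num-scaled i j p k = trans (num-* (fromℤ i) (polynomial (map (⌜ j ⌝ ℚ.*_) p)) k)
    (cong₂ ℚ._*_ (at-constant ⌜ i ⌝ k) (at-scale ⌜ j ⌝ p k))

  den-scaled : ∀ i j p k → den (fromℤ i * polynomial (map (⌜ j ⌝ ℚ.*_) p)) at k ≡ 1ℚ ℚ.* 1ℚ
  den-scaled i j p k = trans (den-∙ (fromℤ i) (polynomial (map (⌜ j ⌝ ℚ.*_) p)) k)
    (cong₂ ℚ._*_ (at-constant 1ℚ k) (at-constant 1ℚ k))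

  e≉0 : e ≉ 0#
  e≉0 e≈0 = den≢0 x (at≡0⇒IsZero (den x) λ k →
    a*b≡0⇒b≡0 (⌜⌝≢0 (proj₁ (proj₂ (clear (den x))))) (a*b≡0⇒b≡0 (⌜⌝≢0 (proj₁ (proj₂ (clear (num x))))) (begin
      ⌜ N ⌝ ℚ.* (⌜ M ⌝ ℚ.* den x at k)    ≡⟨ num-scaled N M (den x) k ⟨
      num e at k                          ≡⟨ ℚₚ.*-identityʳ (num e at k) ⟨
      num e at k ℚ.* 1ℚ                   ≡⟨ cong (num e at k ℚ.*_) (at-constant 1ℚ k) ⟨
      num e at k ℚ.* (1ℚ ∷ []) at k       ≡⟨ ≈-elim e 0# e≈0 k ⟩
      0ℚ ℚ.* den e at k                   ≡⟨ ℚₚ.*-zeroˡ (den e at k) ⟩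
      0ℚ                                  ∎)))
    where open ≡-Reasoning

  y≈ex : y ≈ e * x
  y≈ex = ≈-by y (e * x) (num-scaled M N (num x)) (den-scaled M N (num x))
    (λ k → trans (num-* e x k) (cong (ℚ._* num x at k) (num-scaled N M (den x) k)))
    (λ k → trans (den-∙ e x k) (cong (ℚ._* den x at k) (den-scaled N M (den x) k)))
    (λ k → solve 4 (λ a b n d → b :* (a :* n) :* (con 1ℚ :* con 1ℚ :* d) := a :* (b :* d) :* n :* (con 1ℚ :* con 1ℚ))
      refl ⌜ N ⌝ ⌜ M ⌝ (num x at k) (den x at k))

-- Links the integer values that occur in `IsParametricSolution` with the places m = k.
Val-ι : ∀ k z → Val k (ι z) (eval z k)
Val-ι k z = Val-polynomial (map (ℚ._/ 1) z) (eval z k) (at-ι z)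
  where
  at-ι : ∀ z → map (ℚ._/ 1) z at ⌜ k ⌝ ≡ ⌜ eval z k ⌝
  at-ι []      = refl
  at-ι (a ∷ z) = begin
    ⌜ a ⌝ ℚ.+ ⌜ k ⌝ ℚ.* map (ℚ._/ 1) z at ⌜ k ⌝   ≡⟨ cong (λ r → ⌜ a ⌝ ℚ.+ ⌜ k ⌝ ℚ.* r) (at-ι z) ⟩
    ⌜ a ⌝ ℚ.+ ⌜ k ⌝ ℚ.* ⌜ eval z k ⌝              ≡⟨ cong (⌜ a ⌝ ℚ.+_) (⌜⌝-homo-* k (eval z k)) ⟨
    ⌜ a ⌝ ℚ.+ ⌜ k ℤ.* eval z k ⌝                  ≡⟨ ⌜⌝-homo-+ a (k ℤ.* eval z k) ⟨
    ⌜ a ℤ.+ k ℤ.* eval z k ⌝                      ∎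
    where open ≡-Reasoning

Val-0 : ∀ {k} → Val k 0# ℤ.0ℤ
Val-0 = Val-polynomial [] ℤ.0ℤ refl

Val⇒≉0 : ∀ {k} x c → Val k x c → c ≢ ℤ.0ℤ → x ≉ 0#
Val⇒≉0 x c v c≢0 x≈0 = c≢0 (Val-unique (Val-≈ {x = x} {0#} x≈0 v) Val-0)

#≉0 : ∀ n → fromℤ (ℤ.+ suc n) ≉ 0#
#≉0 n = Val⇒≉0 {ℤ.0ℤ} (fromℤ (ℤ.+ suc n)) (ℤ.+ suc n) (Val-fromℤ (ℤ.+ suc n)) (λ ())

m≉0 : m ≉ 0#
m≉0 = Val⇒≉0 {ℤ.1ℤ} m ℤ.1ℤ Val-m (λ ())

module _ (α β : K) where
  private module W = Weierstrass α β

  if-yes : ∀ {A B : Set} (d : Dec A) {x y : B} → A → (if ⌊ d ⌋ then x else y) ≡ x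
  if-yes (yes _) a = refl
  if-yes (no ¬a) a = contradiction a ¬a

  if-no : ∀ {A B : Set} (d : Dec A) {x y : B} → ¬ A → (if ⌊ d ⌋ then x else y) ≡ y
  if-no (yes a) ¬a = contradiction a ¬a
  if-no (no _)  ¬a = refl

  ⊕-chord : ∀ x₁ y₁ x₂ y₂ → x₁ ≉ x₂ →
    aff x₁ y₁ W.⊕ aff x₂ y₂ ≡ W.third ((y₂ - y₁) / (x₂ - x₁)) x₁ y₁ x₂
  ⊕-chord x₁ y₁ x₂ y₂ x₁≉x₂ = if-no (x₁ ≟ x₂) x₁≉x₂

  ⊕-tangent : ∀ x₁ y₁ → y₁ ≉ - y₁ →
    aff x₁ y₁ W.⊕ aff x₁ y₁ ≡ W.third ((# 3 * x₁ ^ 2 + α) / (# 2 * y₁)) x₁ y₁ x₁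
  ⊕-tangent x₁ y₁ y₁≉-y₁ = trans (if-yes (x₁ ≟ x₁) (≈-refl {x₁})) (if-no (y₁ ≟ - y₁) y₁≉-y₁)

-- Each identity in `K` is evaluated at the place m = k, and uniqueness of values makes it an
-- identity of integers.
squares⇒parametric : ∀ (z : Triple ℤ[m]) zp zq zr (f : Fin 3 → K) p q r →
  (∀ i → ι (z i) ≈ f i) → ι zp ≈ p → ι zq ≈ q → ι zr ≈ r →
  f 0F + f 1F + f 2F ≈ p * p →
  f 0F * f 1F + f 1F * f 2F + f 2F * f 0F ≈ q * q →
  f 0F * f 1F * f 2F ≈ r * r →
  IsParametricSolution z
squares⇒parametric z zp zq zr f p q r hz hp hq hr e₁ e₂ e₃ = zp , zq , zr , λ k →
  let value : ∀ x z → ι z ≈ x → Val k x (eval z k)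
      value x z h = Val-≈ {x = ι z} {x} h (Val-ι k z)
      a = value (f 0F) (z 0F) (hz 0F)
      b = value (f 1F) (z 1F) (hz 1F)
      c = value (f 2F) (z 2F) (hz 2F)
      vp = value p zp hp
      vq = value q zq hq
      vr = value r zr hr
  in Val-unique (Val-≈ {x = f 0F + f 1F + f 2F} {p * p} e₁ (Val-+ (Val-+ a b) c)) (Val-* vp vp)
   , Val-unique (Val-≈ {x = f 0F * f 1F + f 1F * f 2F + f 2F * f 0F} {q * q} e₂
       (Val-+ (Val-+ (Val-* a b) (Val-* b c)) (Val-* c a))) (Val-* vq vq)
   , Val-unique (Val-≈ {x = f 0F * f 1F * f 2F} {r * r} e₃ (Val-* (Val-* a b) c)) (Val-* vr vr)

-- The multiples of P

-- Here m and the constants depending on it are variables, because comparing closed terms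
-- of K makes Agda compute with them.  Matching on Constants, Images and Preimages gives the
-- constants and functions of the statement their definitions.
module Generic (m : K) (m≉0 : m ≉ 0#) (Val-m : ∀ {k} → Val k m k) (Int-m : Int m) where

  module F = FunctionField K-commutativeRing _⁻¹ *-inverseʳ fromℤ-morphism #≉0 m m≉0

  place : ∀ k → F.Place k
  place k = record
    { Val        = Val k
    ; Val-≈      = λ {x} {y} → Val-≈ {k} {x} {y}
    ; Val-fromℤ  = Val-fromℤ
    ; Val-m      = Val-m
    ; Val-+      = Val-+
    ; Val-*      = Val-*
    ; Val-neg    = Val-neg
    ; Val-unique = Val-unique
    ; Val-cancel = Val-cancel
    }

  module BP = F.BasePoint (place ℤ.0ℤ)
  open F.AtZero (place ℤ.0ℤ)

  data Constants : (D α β excludedX xP yP : K) → Set where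
    constants : let D = m ^ 2 + # 1 in Constants D
      (- (# 432 * (m ^ 4 - # 2 * m ^ 2 - # 2) * D ^ 2))
      (- (# 1728 * (m ^ 2 - # 1) * D ^ 3 * (# 2 * m ^ 4 - # 4 * m ^ 2 - # 7)))
      (# 12 * D * (# 2 * m ^ 2 + # 1))
      (- (# 12 * (m ^ 6 - # 4 * m ^ 2 - # 3)) / m ^ 2)
      (# 216 * D ^ 2 / m ^ 3)

  Int-⟦⟧ : ∀ {n} (p : F.Polynomial n) (ρ : Vec K n) → (∀ i → Int (lookup ρ i)) → Int (F.⟦ p ⟧ ρ)
  Int-⟦⟧ (F.op F.[+] p q) ρ h = Int-+ (Int-⟦⟧ p ρ h) (Int-⟦⟧ q ρ h)
  Int-⟦⟧ (F.op F.[*] p q) ρ h = Int-* (Int-⟦⟧ p ρ h) (Int-⟦⟧ q ρ h)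
  Int-⟦⟧ (F.con c)        ρ h = Int-fromℤ c
  Int-⟦⟧ (F.var i)        ρ h = h i
  Int-⟦⟧ (p F.:^ zero)    ρ h = Int-fromℤ ℤ.1ℤ
  Int-⟦⟧ (p F.:^ suc n)   ρ h = Int-* (Int-⟦⟧ p ρ h) (Int-⟦⟧ (p F.:^ n) ρ h)
  Int-⟦⟧ (F.:- p)         ρ h = Int-neg (Int-⟦⟧ p ρ h)

  ScaledTriple : ∀ U V → F.OnQuartic U V → Set
  ScaledTriple U V quartic = Σ[ e ∈ K ] e ≉ 0# × (Σ[ f ∈ Triple ℤ[m] ]
    (∀ i → ι (f i) ≈ F.Triple.f U V e quartic i) × IsParametricSolution f)

  scale : ∀ U V (quartic : F.OnQuartic U V) e₁ e₂ → e₁ ≉ 0# → e₂ ≉ 0# →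
    Int e₁ → Int e₂ → Int (e₁ * U) → Int (e₂ * V) → ScaledTriple U V quartic
  scale U V quartic e₁ e₂ e₁≉0 e₂≉0 int₁ int₂ int₁U int₂V =
    e , F.*-≉0 {e₁} {e₂} e₁≉0 e₂≉0 , (λ i → proj₁ (z i)) , (λ i → proj₂ (z i)) , solution
    where
    e = e₁ * e₂
    module T = F.Triple U V e quartic

    integral : ∀ i → Int (lookup T.env i)
    integral 0F = Int-m
    integral 1F = Int-≈ (e₂ * (e₁ * U)) (e * U)
      (CS.x∙yz≈yx∙z e₂ e₁ U)
      (Int-* int₂ int₁U)
    integral 2F = Int-≈ (e₁ * (e₂ * V)) (e * V)
      (≈-sym {e * V} {e₁ * (e₂ * V)} (*-assoc e₁ e₂ V))
      (Int-* int₁ int₂V)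
    integral 3F = Int-* int₁ int₂

    z : ∀ i → ∃[ z ] ι z ≈ T.f i
    z i = Int⇒ι (Int-⟦⟧ (T.:f i) T.env integral)
    p : ∃[ z ] ι z ≈ T.p
    p = Int⇒ι (Int-⟦⟧ T.:p T.env integral)
    q : ∃[ z ] ι z ≈ T.q
    q = Int⇒ι (Int-⟦⟧ T.:q T.env integral)
    r : ∃[ z ] ι z ≈ T.r
    r = Int⇒ι (Int-⟦⟧ T.:r T.env integral)

    solution : IsParametricSolution (λ i → proj₁ (z i))
    solution = squares⇒parametric (λ i → proj₁ (z i)) (proj₁ p) (proj₁ q) (proj₁ r) T.f T.p T.q T.r
      (λ i → proj₂ (z i)) (proj₂ p) (proj₂ q) (proj₂ r) T.e₁-square T.e₂-square T.e₃-square

  scaledTriple : ∀ U V (quartic : F.OnQuartic U V) → ScaledTriple U V quartic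
  scaledTriple U V quartic =
    let e₁ , e₁≉0 , int₁ , int₁U = commonDenominator U
        e₂ , e₂≉0 , int₂ , int₂V = commonDenominator V
    in scale U V quartic e₁ e₂ e₁≉0 e₂≉0 int₁ int₂ int₁U int₂V

  nonsingular : ∀ {D α β excludedX xP yP} → Constants D α β excludedX xP yP → Weierstrass.Nonsingular α β
  nonsingular constants = BP.nonsingular

  P-onCurve : ∀ {D α β excludedX xP yP} → Constants D α β excludedX xP yP →
    Weierstrass.OnCurve α β (aff xP yP)
  P-onCurve constants = BP.P-onCurve

  P-leading : ∀ {D α β excludedX xP yP} → Constants D α β excludedX xP yP → Leading ℤ.1ℤ xP yP
  P-leading constants = BP.P-leading

  yP≉-yP : ∀ {D α β excludedX xP yP} → Constants D α β excludedX xP yP → yP ≉ - yP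
  yP≉-yP constants = BP.Doubling.yP≉-yP 0#

  double : ∀ {D α β excludedX xP yP} → Constants D α β excludedX xP yP →
    ∀ l → l ≡ (# 3 * xP ^ 2 + α) / (# 2 * yP) →
    let x₃ = l ^ 2 - xP - xP ; y₃ = l * (xP - x₃) - yP in
    Weierstrass.OnCurve α β (aff x₃ y₃) × Leading (ℤ.+ 2) x₃ y₃
  double constants l refl = BP.Doubling.double l (≈-refl {l})

  -- The number is 36 (1 - ν) (1 + ν), and chords are drawn only from ν = 2 on.
  nondegenerate : ∀ n → let ν = ℤ.+ suc (suc n) in ℤ.+ 36 ℤ.- ℤ.+ 36 ℤ.* ν ℤ.^ 2 ≢ ℤ.0ℤ
  nondegenerate n = lemma (ℤ.+ suc (suc n)) (λ ()) (λ ())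
    where
    lemma : ∀ ν → ℤ.1ℤ ℤ.- ν ≢ ℤ.0ℤ → ℤ.1ℤ ℤ.+ ν ≢ ℤ.0ℤ → ℤ.+ 36 ℤ.- ℤ.+ 36 ℤ.* ν ℤ.^ 2 ≢ ℤ.0ℤ
    lemma ν 1-ν≢0 1+ν≢0 e = [ 1-ν≢0 , 1+ν≢0 ]′
      (ℤₚ.i*j≡0⇒i≡0∨j≡0 (ℤ.1ℤ ℤ.- ν) (ℤₚ.*-cancelˡ-≡ (ℤ.+ 36) _ ℤ.0ℤ (trans factored e)))
      where
      factored : ℤ.+ 36 ℤ.* ((ℤ.1ℤ ℤ.- ν) ℤ.* (ℤ.1ℤ ℤ.+ ν)) ≡ ℤ.+ 36 ℤ.- ℤ.+ 36 ℤ.* ν ℤ.^ 2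
      factored = Z.solve 1 (λ ν → let 36′ = Z.con (ℤ.+ 36) ; 1′ = Z.con ℤ.1ℤ in
        36′ Z.:* ((1′ Z.:- ν) Z.:* (1′ Z.:+ ν)) Z.:= 36′ Z.:- 36′ Z.:* ν Z.:^ 2) refl ν

  xP≉x : ∀ {D α β excludedX xP yP} → Constants D α β excludedX xP yP →
    ∀ n x y → Weierstrass.OnCurve α β (aff x y) → Leading (ℤ.+ suc (suc n)) x y → xP ≉ x
  xP≉x constants n x y onCurve lead =
    BP.Chord.xP≉x₂ (ℤ.+ suc (suc n)) (λ ()) (nondegenerate n) {x} {y} onCurve lead

  chord : ∀ {D α β excludedX xP yP} → Constants D α β excludedX xP yP →
    ∀ n x y → Weierstrass.OnCurve α β (aff x y) → Leading (ℤ.+ suc (suc n)) x y →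
    ∀ l → l ≡ (y - yP) / (x - xP) →
    let x₃ = l ^ 2 - xP - x ; y₃ = l * (xP - x₃) - yP in
    Weierstrass.OnCurve α β (aff x₃ y₃) × Leading (ℤ.+ suc (suc (suc n))) x₃ y₃
  chord constants n x y onCurve lead l refl =
    BP.Chord.chord (ℤ.+ suc (suc n)) (λ ()) (nondegenerate n) {x} {y} onCurve lead l (≈-refl {l})

  module Multiples {D α β excludedX xP yP : K} (c : Constants D α β excludedX xP yP) where
    private
      module W = Weierstrass α β
      base = aff xP yP

    Multiple : ℕ → Set
    Multiple n = Σ[ x ∈ K ] Σ[ y ∈ K ]
      suc n W.· base ≡ aff x y × W.OnCurve (aff x y) × Leading (ℤ.+ suc n) x y

    -- `base` is always added on the left, so the second multiple is a tangent case and every later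
    -- one a chord; the leading terms rule out the remaining branches of the group law.
    multiple : ∀ n → Multiple n
    multiple zero = xP , yP , refl , P-onCurve c , P-leading c
    multiple (suc zero) = _ , _ , ⊕-tangent α β xP yP (yP≉-yP c) , double c _ refl
    multiple (suc (suc n)) = next (multiple (suc n))
      where
      next : Multiple (suc n) → Multiple (suc (suc n))
      next (x , y , eq , onCurve , lead) = _ , _ ,
        trans (cong (base W.⊕_) eq) (⊕-chord α β xP yP x y (xP≉x c n x y onCurve lead)) ,
        chord c n x y onCurve lead _ refl

    multiple-≉∞ : ∀ n → suc n W.· base ≉ₚ ∞
    multiple-≉∞ n = let _ , _ , eq , _ = multiple n in subst (_≉ₚ ∞) (sym eq) (λ ())

    multiple-onCurve : ∀ n → W.OnCurve (n W.· base)
    multiple-onCurve zero    = tt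
    multiple-onCurve (suc n) = let _ , _ , eq , onCurve , _ = multiple n in
      subst W.OnCurve (sym eq) onCurve

    multiple-injective : ∀ i j → i ≢ j → i W.· base ≉ₚ j W.· base
    multiple-injective zero    zero    i≢j _ = i≢j refl
    multiple-injective zero    (suc j) _   e =
      let _ , _ , eq , _ = multiple j in subst (∞ ≉ₚ_) (sym eq) (λ ()) e
    multiple-injective (suc i) zero    _   e = multiple-≉∞ i e
    multiple-injective (suc i) (suc j) i≢j e =
      let x , y , eq , _ , lead = multiple i
          x′ , y′ , eq′ , _ , lead′ = multiple j
          x≈x′ , y≈y′ = subst (aff x y ≈ₚ_) eq′ (subst (_≈ₚ suc j W.· base) eq e)
      in i≢j (ℤₚ.+-injective (Leading-injective lead lead′ x≈x′ y≈y′))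

  QuarticD : (D U V : K) → Set
  QuarticD D U V = V ^ 2 ≈ U ^ 4 - # 4 * D * U ^ 3
          - # 2 * D * (# 2 * m ^ 4 - # 2 * m ^ 2 - # 3) * U ^ 2
          - # 4 * D ^ 2 * U + D ^ 2

  data Images (D excludedX X Y : K) : (U V : K) → Set where
    images : let U = (m * Y + # 6 * D * X + # 72 * D ^ 2 * (m ^ 2 - # 1)) / (# 6 * (X - excludedX)) in
      Images D excludedX X Y U
        (m ^ 2 * (X + # 12 * (m ^ 4 - # 1)) / # 18 - (U ^ 2 - # 2 * D * U + D))

  data Preimages (D U V : K) : (X Y : K) → Set where
    preimages : let Z = V + U ^ 2 - # 2 * D * U + D in
      Preimages D U V (# 18 * Z / m ^ 2 - # 12 * (m ^ 4 - # 1))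
        (# 108 * (U * (Z - # 2 * D * m ^ 4) - D * Z) / m ^ 3)

  forward : ∀ {D α β excludedX xP yP} → Constants D α β excludedX xP yP →
    ∀ X Y U V X′ Y′ → Images D excludedX X Y U V → Preimages D U V X′ Y′ →
    Weierstrass.OnCurve α β (aff X Y) → X ≉ excludedX →
    QuarticD D U V × X′ ≈ X × Y′ ≈ Y
  forward constants X Y _ _ _ _ images preimages onCurve X≉ = T.onQuartic , T.fromX-toUV , T.fromY-toUV
    where module T = F.Forward X Y onCurve X≉

  backward : ∀ {D α β excludedX xP yP} → Constants D α β excludedX xP yP →
    ∀ U V X Y U′ V′ → Preimages D U V X Y → Images D excludedX X Y U′ V′ →
    QuarticD D U V →
    Weierstrass.OnCurve α β (aff X Y) × (X ≉ excludedX → U′ ≈ U × V′ ≈ V)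
  backward constants U V _ _ _ _ preimages images quartic =
    T.onCurve , λ X≉ → T.toU-fromXY X≉ , T.toV-fromXY X≉
    where module T = F.Backward U V quartic

  leading⇒≉excluded : ∀ {D α β excludedX xP yP} → Constants D α β excludedX xP yP →
    ∀ ν X Y → Leading ν X Y → X ≉ excludedX
  leading⇒≉excluded constants ν X Y lead = X≉excluded {ν} {X} {Y} lead

  leading⇒U-val : ∀ {D α β excludedX xP yP} → Constants D α β excludedX xP yP →
    ∀ ν X Y U V → Images D excludedX X Y U V → Leading ν X Y → Val ℤ.0ℤ (fromℤ ν * U) (ℤ.1ℤ ℤ.+ ν)
  leading⇒U-val constants ν X Y _ _ images lead = toU-val {ν} {X} {Y} lead

  quartic⇒ : ∀ {D α β excludedX xP yP} → Constants D α β excludedX xP yP →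
    ∀ U V → QuarticD D U V → F.OnQuartic U V
  quartic⇒ constants U V quartic = quartic

  diophantine : ∀ U V → F.OnQuartic U V → ∀ s → s ≉ 0# → Diophantine s (m * s) (s * U) (s ^ 2 * V)
  diophantine U V quartic s s≉0 = F.Diophantine.diophantine s s≉0 U V quartic

  arises : ∀ U V (quartic : F.OnQuartic U V) ((_ , _ , f , _) : ScaledTriple U V quartic) →
    ∀ s → s ≉ 0# → ArisesFrom s (m * s) (s * U) f
  arises U V quartic (e , e≉0 , f , f≈ , _) s s≉0 =
    S.x₁ , S.x₂ , S.g , S.roots , S.g≉0 ,
    ≈-trans {ι (f 0F)} {T.f 0F} {S.g ^ 2 * (s ^ 2 + (m * s) ^ 2)} (f≈ 0F) S.f₀≈ ,
    ≈-trans {ι (f 1F)} {T.f 1F} {S.g ^ 2 * S.x₁} (f≈ 1F) S.f₁≈ ,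
    ≈-trans {ι (f 2F)} {T.f 2F} {S.g ^ 2 * S.x₂} (f≈ 2F) S.f₂≈
    where
    module T = F.Triple U V e quartic
    module S = T.Scaled e≉0 s s≉0

  private
    -- ((n + 1) (n + 2))², with the trailing factor 1 that the unfolded square leaves.
    g : ℕ → ℕ
    g n = suc n ℕ.* suc (suc n) ℕ.* (suc n ℕ.* suc (suc n) ℕ.* 1)

    g-mono : ∀ {i j} → i ℕ.< j → g i ℕ.< g j
    g-mono i<j = ℕₚ.*-mono-< h (ℕₚ.*-monoˡ-< 1 h)
      where h = ℕₚ.*-mono-< (ℕ.s≤s i<j) (ℕ.s≤s (ℕ.s≤s i<j))

    g-injective : ∀ i j → g i ≡ g j → i ≡ j
    g-injective i j e with ℕₚ.<-cmp i j
    ... | tri< i<j _ _ = contradiction e (ℕₚ.<⇒≢ (g-mono i<j))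
    ... | tri≈ _ i≡j _ = i≡j
    ... | tri> _ _ j<i = contradiction (sym e) (ℕₚ.<⇒≢ (g-mono j<i))

    pos-square : ∀ n → (ℤ.+ n) ℤ.^ 2 ≡ ℤ.+ (n ℕ.* (n ℕ.* 1))
    pos-square n = trans (cong (ℤ.+ n ℤ.*_) (sym (ℤₚ.pos-* n 1))) (sym (ℤₚ.pos-* n (n ℕ.* 1)))

    pos-g : ∀ n → (ℤ.+ suc n ℤ.* ℤ.+ suc (suc n)) ℤ.^ 2 ≡ ℤ.+ g n
    pos-g n = trans (cong (ℤ._^ 2) (sym (ℤₚ.pos-* (suc n) (suc (suc n))))) (pos-square (suc n ℕ.* suc (suc n)))

    ℤ-injective : ∀ i j → (ℤ.+ suc i ℤ.* ℤ.+ suc (suc i)) ℤ.^ 2 ≡ (ℤ.+ suc j ℤ.* ℤ.+ suc (suc j)) ℤ.^ 2 → i ≡ j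
    ℤ-injective i j e = g-injective i j (ℤₚ.+-injective (trans (sym (pos-g i)) (trans e (pos-g j))))

    invariant : ∀ ν μ U U′ → Val ℤ.0ℤ (fromℤ ν * U) (ℤ.1ℤ ℤ.+ ν) → Val ℤ.0ℤ (fromℤ μ * U′) (ℤ.1ℤ ℤ.+ μ) →
      ((F.D F.- U) * (U F.- F.# 1) * U′) F.^ 2 ≈ ((F.D F.- U′) * (U′ F.- F.# 1) * U) F.^ 2 →
      (ν ℤ.* (ℤ.1ℤ ℤ.+ ν)) ℤ.^ 2 ≡ (μ ℤ.* (ℤ.1ℤ ℤ.+ μ)) ℤ.^ 2
    invariant ν μ U U′ vU vU′ e = sym (invariant-val {ν} {μ} {U} {U′} vU vU′ e)

  notSimilar : ∀ i j U V U′ V′ (quartic : F.OnQuartic U V) (quartic′ : F.OnQuartic U′ V′) →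
    Val ℤ.0ℤ (fromℤ (ℤ.+ suc i) * U) (ℤ.+ suc (suc i)) →
    Val ℤ.0ℤ (fromℤ (ℤ.+ suc j) * U′) (ℤ.+ suc (suc j)) →
    ((_ , _ , f , _) : ScaledTriple U V quartic) ((_ , _ , f′ , _) : ScaledTriple U′ V′ quartic′) →
    i ≢ j → ¬ Similar f f′
  notSimilar i j U V U′ V′ quartic quartic′ vU vU′ (e , e≉0 , f , f≈ , _) (e′ , e′≉0 , f′ , f′≈ , _) i≢j
    (σ , c , _ , similar) = i≢j (ℤ-injective i j
      (invariant (ℤ.+ suc i) (ℤ.+ suc j) U U′ vU vU′
        (F.SimilarTriples.similar⇒ {U} {V} {e} {U′} {V′} {e′} quartic quartic′ e≉0 e′≉0 BP.D≉0 σ c proportional)))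
    where
    module T = F.Triple U V e quartic
    module T′ = F.Triple U′ V′ e′ quartic′

    proportional : ∀ l → T.f l ≈ c * T′.f (σ ⟨$⟩ʳ l)
    proportional l = ≈-trans {T.f l} {ι (f l)} {c * T′.f (σ ⟨$⟩ʳ l)} (≈-sym {ι (f l)} {T.f l} (f≈ l))
      (≈-trans {ι (f l)} {c * ι (f′ (σ ⟨$⟩ʳ l))} {c * T′.f (σ ⟨$⟩ʳ l)} (similar l)
        (*-cong {c} {c} {ι (f′ (σ ⟨$⟩ʳ l))} {T′.f (σ ⟨$⟩ʳ l)} (≈-refl {c}) (f′≈ (σ ⟨$⟩ʳ l))))

  U-distinct : ∀ i j U U′ →
    Val ℤ.0ℤ (fromℤ (ℤ.+ suc i) * U) (ℤ.+ suc (suc i)) →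
    Val ℤ.0ℤ (fromℤ (ℤ.+ suc j) * U′) (ℤ.+ suc (suc j)) →
    i ≢ j → U ≉ U′
  U-distinct i j U U′ vU vU′ i≢j U≈U′ =
    i≢j (ℕₚ.suc-injective (ℤₚ.+-injective (U-injective {ℤ.+ suc i} {ℤ.+ suc j} {U} {U′} vU vU′ U≈U′)))

-- Specialisation to the indeterminate m

module G = Generic m m≉0 Val-m Int-m

constants : G.Constants D
  (- (# 432 * (m ^ 4 - # 2 * m ^ 2 - # 2) * D ^ 2))
  (- (# 1728 * (m ^ 2 - # 1) * D ^ 3 * (# 2 * m ^ 4 - # 4 * m ^ 2 - # 7)))
  excludedX
  (- (# 12 * (m ^ 6 - # 4 * m ^ 2 - # 3)) / m ^ 2)
  (# 216 * D ^ 2 / m ^ 3)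
constants = G.constants

images : ∀ X Y → G.Images D excludedX X Y (toU X Y) (toV X Y)
images X Y = G.images

preimages : ∀ U V → G.Preimages D U V (fromX U V) (fromY U V)
preimages U V = G.preimages

module Mul = G.Multiples constants

X Y U V : ℕ → K
X n = proj₁ (Mul.multiple n)
Y n = proj₁ (proj₂ (Mul.multiple n))
U n = toU (X n) (Y n)
V n = toV (X n) (Y n)

X≉excludedX : ∀ n → X n ≉ excludedX
X≉excludedX n = let x , y , _ , _ , lead = Mul.multiple n in
  G.leading⇒≉excluded constants (ℤ.+ suc n) x y lead

forward : ∀ X Y → E.OnCurve (aff X Y) → X ≉ excludedX →
         OnQuartic (toU X Y) (toV X Y)
         × fromX (toU X Y) (toV X Y) ≈ X
         × fromY (toU X Y) (toV X Y) ≈ Y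
forward X Y = G.forward constants X Y (toU X Y) (toV X Y) _ _ (images X Y) (preimages (toU X Y) (toV X Y))

backward : ∀ U V → OnQuartic U V →
         E.OnCurve (aff (fromX U V) (fromY U V))
         × (fromX U V ≉ excludedX →
              toU (fromX U V) (fromY U V) ≈ U
              × toV (fromX U V) (fromY U V) ≈ V)
backward U V = G.backward constants U V (fromX U V) (fromY U V) _ _ (preimages U V) (images (fromX U V) (fromY U V))

quartic : ∀ n → OnQuartic (U n) (V n)
quartic n = let x , y , _ , onCurve , _ = Mul.multiple n in
  proj₁ (forward x y onCurve (X≉excludedX n))

U-val : ∀ n → Val ℤ.0ℤ (fromℤ (ℤ.+ suc n) * U n) (ℤ.+ suc (suc n))
U-val n = let x , y , _ , _ , lead = Mul.multiple n in
  G.leading⇒U-val constants (ℤ.+ suc n) x y (U n) (V n) (images x y) lead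

quarticF : ∀ n → G.F.OnQuartic (U n) (V n)
quarticF n = G.quartic⇒ constants (U n) (V n) (quartic n)

triple : ∀ n → G.ScaledTriple (U n) (V n) (quarticF n)
triple n = G.scaledTriple (U n) (V n) (quarticF n)

multiple≈ : ∀ n → suc n E.· P ≈ₚ aff (X n) (Y n)
multiple≈ n = let x , y , eq , _ = Mul.multiple n in
  subst (_≈ₚ aff x y) (sym eq) (≈-refl {x} , ≈-refl {y})

mainTheorem5 :
    -- (i)
    ( E.Nonsingular
    × E.OnCurve P
    × (∀ n → suc n E.· P ≉ₚ ∞)
    × (∀ n → E.OnCurve (n E.· P))
    × (∀ i j → i ≢ j → i E.· P ≉ₚ j E.· P)
    )
    ×
    -- the birational transformation between the two curves
    ( (∀ X Y → E.OnCurve (aff X Y) → X ≉ excludedX →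
         OnQuartic (toU X Y) (toV X Y)
         × fromX (toU X Y) (toV X Y) ≈ X
         × fromY (toU X Y) (toV X Y) ≈ Y)
    × (∀ U V → OnQuartic U V →
         E.OnCurve (aff (fromX U V) (fromY U V))
         × (fromX U V ≉ excludedX →
              toU (fromX U V) (fromY U V) ≈ U
              × toV (fromX U V) (fromY U V) ≈ V))
    )
    ×
    -- (ii)
    ( Σ[ X ∈ (ℕ → K) ] Σ[ Y ∈ (ℕ → K) ]
      (∀ (n : ℕ) → (suc n E.· P ≈ₚ aff (X n) (Y n)) × X n ≉ excludedX)
      ×
      ( let U = λ n → toU (X n) (Y n)
            V = λ n → toV (X n) (Y n)
        in
        (∀ n → OnQuartic (U n) (V n))
        × (∀ i j → i ≢ j → U i ≉ U j)
        × (∀ n s → s ≉ 0# → Diophantine s (m * s) (s * U n) (s ^ 2 * V n))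
        ×
        -- (iii)
        (∀ s → s ≉ 0# →
           Σ[ f ∈ (ℕ → Triple ℤ[m]) ]
             (∀ n → IsParametricSolution (f n)
                     × ArisesFrom s (m * s) (s * U n) (f n))
             × (∀ i j → i ≢ j → ¬ Similar (f i) (f j)))
      )
    )
mainTheorem5 =
  ( G.nonsingular constants
  , G.P-onCurve constants
  , Mul.multiple-≉∞
  , Mul.multiple-onCurve
  , Mul.multiple-injective
  ) ,
  (forward , backward) ,
  X , Y , (λ n → multiple≈ n , X≉excludedX n) ,
  quartic ,
  (λ i j → G.U-distinct i j (U i) (U j) (U-val i) (U-val j)) ,
  (λ n → G.diophantine (U n) (V n) (quarticF n)) ,
  -- The same triples serve for every `s`; only the scaling factor in `ArisesFrom` depends on it.
  λ s s≉0 → (λ n → proj₁ (proj₂ (proj₂ (triple n)))) ,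
    (λ n → proj₂ (proj₂ (proj₂ (proj₂ (triple n)))) , G.arises (U n) (V n) (quarticF n) (triple n) s s≉0) ,
    λ i j → G.notSimilar i j (U i) (V i) (U j) (V j) (quarticF i) (quarticF j) (U-val i) (U-val j) (triple i) (triple j)
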